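{- For $n\ge 0$ define the polynomial $$P_n(x_1,x_2,y_1,y_2,u_1,u_2,v_1,v_2,w_{\mathrm e},w_{\mathrm o},z_{\mathrm e},z_{\mathrm o})=\sum_{\sigma\in\mathfrak{D}_{2n}} x_1^{\mathrm{eareccpeak}(\sigma)}x_2^{\mathrm{eareccdfall}(\sigma)}y_1^{\mathrm{ereccval}(\sigma)}y_2^{\mathrm{ereccdrise}(\sigma)}u_1^{\mathrm{nrcpeak}(\sigma)}u_2^{\mathrm{nrcdfall}(\sigma)}v_1^{\mathrm{nrcval}(\sigma)}v_2^{\mathrm{nrcdrise}(\sigma)}w_{\mathrm e}^{\mathrm{evennrfix}(\sigma)}w_{\mathrm o}^{\mathrm{oddnrfix}(\sigma)}z_{\mathrm e}^{\mathrm{evenrar}(\sigma)}z_{\mathrm o}^{\mathrm{oddrar}(\sigma)}.$$ Then, as an identity of formal power series in $t$ with coefficients in the polynomial ring in these 12 variables, $\sum_{n\ge0}P_n\,t^n$ equals the T-type continued fraction with coefficients $\alpha_{2k-1}=[x_1+(k-1)u_1]\,[y_1+(k-1)v_1]$, $\alpha_{2k}=[x_2+(k-1)u_2+w_{\mathrm e}]\,[y_2+(k-1)v_2+w_{\mathrm o}]$ for $k\ge1$, $\delta_1=z_{\mathrm e}z_{\mathrm o}$, and $\delta_n=0$ for $n\ge2$.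
   Context: For $n\ge0$, a D-permutation of $[2n]=\{1,\dots,2n\}$ is a permutation $\sigma$ of $[2n]$ with $\sigma(2k-1)\ge 2k-1$ and $\sigma(2k)\le 2k$ for all $k\in[n]$; $\mathfrak{D}_{2n}$ is the set of them ($\mathfrak D_0$ consists of the empty permutation). For a permutation $\sigma$ and an index $i$: $i$ is a cycle peak if $\sigma^{ -1}(i)<i>\sigma(i)$, a cycle valley if $\sigma^{ -1}(i)>i<\sigma(i)$, a cycle double rise if $\sigma^{ -1}(i)<i<\sigma(i)$, a cycle double fall if $\sigma^{ -1}(i)>i>\sigma(i)$, a fixed point if $\sigma(i)=i$. The index $i$ is a record if $\sigma(j)<\sigma(i)$ for all $j<i$, an antirecord if $\sigma(j)>\sigma(i)$ for all $j>i$; an exclusive record is a record that is not an antirecord, an exclusive antirecord is an antirecord that is not a record, a record-antirecord is both, and a neither-record-antirecord is neither. Statistics: $\mathrm{eareccpeak}(\sigma)$ = number of indices that are exclusive antirecords and cycle peaks; $\mathrm{eareccdfall}$ = exclusive antirecords that are cycle double falls; $\mathrm{ereccval}$ = exclusive records that are cycle valleys; $\mathrm{ereccdrise}$ = exclusive records that are cycle double rises; $\mathrm{nrcpeak},\mathrm{nrcdfall},\mathrm{nrcval},\mathrm{nrcdrise}$ = neither-record-antirecords that are respectively cycle peaks, cycle double falls, cycle valleys, cycle double rises; $\mathrm{evennrfix},\mathrm{oddnrfix}$ = even, resp. odd, fixed points that are neither-record-antirecords; $\mathrm{evenrar},\mathrm{oddrar}$ = even, resp. odd, indices that are record-antirecords.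 Given sequences $(\alpha_n)_{n\ge1}$, $(\delta_n)_{n\ge1}$, the T-type continued fraction with these coefficients is the formal power series $$\cfrac{1}{1-\delta_1 t-\cfrac{\alpha_1 t}{1-\delta_2 t-\cfrac{\alpha_2 t}{1-\delta_3 t-\cdots}}}.$$ -}

module Defs where

open import Level using (Level)
open import Data.Bool using (Bool; true; false; _∧_; _∨_; not; if_then_else_)
open import Data.Nat as ℕ using (ℕ; zero; suc; _∸_)
open import Data.Nat.DivMod using (_/_; _%_)
open import Data.Fin as Fin using (Fin; toℕ)
open import Data.Vec as Vec using (Vec; []; _∷_; lookup)
open import Data.List as List using (List; []; _∷_; concatMap; foldr; filter)
import Data.List.Base as LB
import Data.Bool.ListAction as BL
open import Relation.Nullary.Decidable using (⌊_⌋)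
open import Algebra.Bundles using (CommutativeRing)

-- Convention: a map σ : [m] → [m] is represented as a vector of length m;
-- position i : Fin m stands for the integer i+1 ∈ [m], and so do values.
Map : ℕ → Set
Map m = Vec (Fin m) m

allVecs : (m k : ℕ) → List (Vec (Fin m) k)
allVecs m zero    = [] ∷ []
allVecs m (suc k) = concatMap (λ v → LB.map (λ a → a ∷ v) (List.allFin m)) (allVecs m k)

_<ᵇ_ : ∀ {m} → Fin m → Fin m → Bool
i <ᵇ j = toℕ i ℕ.<ᵇ toℕ j

_==ᵇ_ : ∀ {m} → Fin m → Fin m → Bool
i ==ᵇ j = ⌊ i Fin.≟ j ⌋

anyFin : ∀ m → (Fin m → Bool) → Bool
anyFin m p = BL.any p (List.allFin m)

allFin : ∀ m → (Fin m → Bool) → Bool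
allFin m p = BL.all p (List.allFin m)

module _ {m : ℕ} (σ : Map m) where
  app : Fin m → Fin m
  app i = lookup σ i

  -- σ is a permutation (injective, hence bijective on a finite set)
  isPerm : Bool
  isPerm = allFin m (λ i → allFin m (λ j → not (app i ==ᵇ app j) ∨ (i ==ᵇ j)))

  -- the integer represented by i is toℕ i + 1; it is odd iff toℕ i is even
  oddIdx : Fin m → Bool
  oddIdx i = toℕ i % 2 ℕ.≡ᵇ 0

  isDcond : Bool
  isDcond = allFin m (λ i → if oddIdx i then not (app i <ᵇ i) else not (i <ᵇ app i))

  preLess preGreater : Fin m → Bool
  preLess    i = anyFin m (λ j → (app j ==ᵇ i) ∧ (j <ᵇ i))
  preGreater i = anyFin m (λ j → (app j ==ᵇ i) ∧ (i <ᵇ j))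

  cpeak cval cdrise cdfall fixpt : Fin m → Bool
  cpeak  i = preLess i ∧ (app i <ᵇ i)
  cval   i = preGreater i ∧ (i <ᵇ app i)
  cdrise i = preLess i ∧ (i <ᵇ app i)
  cdfall i = preGreater i ∧ (app i <ᵇ i)
  fixpt  i = app i ==ᵇ i

  isRecord isAntirecord : Fin m → Bool
  isRecord     i = allFin m (λ j → not (j <ᵇ i) ∨ (app j <ᵇ app i))
  isAntirecord i = allFin m (λ j → not (i <ᵇ j) ∨ (app i <ᵇ app j))

  erec earec rar nra : Fin m → Bool
  erec  i = isRecord i ∧ not (isAntirecord i)
  earec i = isAntirecord i ∧ not (isRecord i)
  rar   i = isRecord i ∧ isAntirecord i
  nra   i = not (isRecord i) ∧ not (isAntirecord i)

  count : (Fin m → Bool) → ℕ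
  count p = List.length (filter (λ i → p i Data.Bool.≟ true) (List.allFin m))

  eareccpeak eareccdfall ereccval ereccdrise : ℕ
  eareccpeak  = count (λ i → earec i ∧ cpeak i)
  eareccdfall = count (λ i → earec i ∧ cdfall i)
  ereccval    = count (λ i → erec i ∧ cval i)
  ereccdrise  = count (λ i → erec i ∧ cdrise i)

  nrcpeak nrcdfall nrcval nrcdrise : ℕ
  nrcpeak  = count (λ i → nra i ∧ cpeak i)
  nrcdfall = count (λ i → nra i ∧ cdfall i)
  nrcval   = count (λ i → nra i ∧ cval i)
  nrcdrise = count (λ i → nra i ∧ cdrise i)

  evennrfix oddnrfix evenrar oddrar : ℕ
  evennrfix = count (λ i → nra i ∧ fixpt i ∧ not (oddIdx i))
  oddnrfix  = count (λ i → nra i ∧ fixpt i ∧ oddIdx i)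
  evenrar   = count (λ i → rar i ∧ not (oddIdx i))
  oddrar    = count (λ i → rar i ∧ oddIdx i)

Dperms : (n : ℕ) → List (Map (2 ℕ.* n))
Dperms n = filter (λ σ → (isPerm σ ∧ isDcond σ) Data.Bool.≟ true) (allVecs (2 ℕ.* n) (2 ℕ.* n))

module Ring {c ℓ : Level} (R : CommutativeRing c ℓ) where
  open CommutativeRing R
  open import Algebra.Bundles using (Semiring)
  open import Algebra.Definitions.RawSemiring (Semiring.rawSemiring semiring) using (_^_)

  _·_ : ℕ → Carrier → Carrier
  zero  · a = 0#
  suc k · a = a + k · a

  sumL : List Carrier → Carrier
  sumL = foldr _+_ 0#

  P : (x₁ x₂ y₁ y₂ u₁ u₂ v₁ v₂ wₑ wₒ zₑ zₒ : Carrier) → ℕ → Carrier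
  P x₁ x₂ y₁ y₂ u₁ u₂ v₁ v₂ wₑ wₒ zₑ zₒ n =
    sumL (LB.map (λ σ →
        (x₁ ^ eareccpeak σ) * (x₂ ^ eareccdfall σ) * (y₁ ^ ereccval σ) * (y₂ ^ ereccdrise σ)
      * (u₁ ^ nrcpeak σ) * (u₂ ^ nrcdfall σ) * (v₁ ^ nrcval σ) * (v₂ ^ nrcdrise σ)
      * (wₑ ^ evennrfix σ) * (wₒ ^ oddnrfix σ) * (zₑ ^ evenrar σ) * (zₒ ^ oddrar σ))
      (Dperms n))

  Series : Set c
  Series = ℕ → Carrier

  zeroS oneS : Series
  zeroS _ = 0#
  oneS zero    = 1#
  oneS (suc _) = 0#

  _+S_ : Series → Series → Series
  (f +S g) n = f n + g n

  scale : Carrier → Series → Series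
  scale a f n = a * f n

  _*S_ : Series → Series → Series
  (f *S g) n = sumL (LB.map (λ i → f i * g (n ∸ i)) (List.upTo (suc n)))

  shiftS : Series → Series
  shiftS f zero    = 0#
  shiftS f (suc n) = f n

  powS : Series → ℕ → Series
  powS f zero    = oneS
  powS f (suc k) = f *S powS f k

  -- 1/(1 - g) = Σ_k g^k, for g with zero constant term
  -- (the coefficient of t^n only involves k ≤ n)
  geomS : Series → Series
  geomS g n = sumL (LB.map (λ k → powS g k n) (List.upTo (suc n)))

  -- Depth-d convergent of the T-fraction starting at level k (levels are 1-based):
  --   T^{(0)}_k = 0,   T^{(d+1)}_k = 1 / (1 - δ_k t - α_k t T^{(d)}_{k+1}).
  convergent : (α δ : ℕ → Carrier) → ℕ → ℕ → Series
  convergent α δ zero    k = zeroS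
  convergent α δ (suc d) k =
    geomS (shiftS (scale (δ k) oneS +S scale (α k) (convergent α δ d (suc k))))

  -- coefficients of the theorem (1-based; the value at 0 is never used)
  alphaCoeff : (x₁ x₂ y₁ y₂ u₁ u₂ v₁ v₂ wₑ wₒ : Carrier) → ℕ → Carrier
  alphaCoeff x₁ x₂ y₁ y₂ u₁ u₂ v₁ v₂ wₑ wₒ zero = 0#
  alphaCoeff x₁ x₂ y₁ y₂ u₁ u₂ v₁ v₂ wₑ wₒ (suc m) =
    -- n = m+1; if n = 2k-1 then m = 2(k-1); if n = 2k then m = 2(k-1)+1; in both cases k-1 = m / 2
    if m % 2 ℕ.≡ᵇ 0
    then (x₁ + (m / 2) · u₁) * (y₁ + (m / 2) · v₁)
    else (x₂ + (m / 2) · u₂ + wₑ) * (y₂ + (m / 2) · v₂ + wₒ)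

  deltaCoeff : (zₑ zₒ : Carrier) → ℕ → Carrier
  deltaCoeff zₑ zₒ 1 = zₑ * zₒ
  deltaCoeff zₑ zₒ _ = 0#

{-# OPTIONS --safe #-}
-- Build a D-permutation σ from the right. Together with σ(p), the suffix occupying the
-- positions above p determines every statistic at p: p is a record iff all values larger
-- than σ(p) occur in the suffix, an antirecord iff σ(p) is smaller than all suffix values,
-- and σ⁻¹(p) > p iff p occurs in the suffix. Pigeonhole says that as many values above p are
-- missing from the suffix as values up to p occur in it, so the total weight of the
-- suffixes in which a prescribed set of values below p occurs depends only on its size k.
-- This gives a transfer recursion in k with two half-steps (odd index, even index) per
-- unit of n, which is the path expansion of the T-fraction with its levels paired up.
module Submission where

open import Defs hiding (_<ᵇ_; _==ᵇ_; allFin)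
open import Level using (Level)
open import Algebra.Bundles using (CommutativeRing; Semiring)
open import Data.Bool as Bool using (Bool; true; false; T; _∧_; _∨_; not; if_then_else_)
open import Data.Bool.Properties using (T-∧; T-≡; T?; ∧-zeroʳ; ∧-comm; ∧-identityʳ)
open import Data.Empty using (⊥; ⊥-elim)
open import Data.Fin as Fin using (Fin; toℕ; zero; suc)
open import Data.Fin.Properties using (toℕ-injective; toℕ<n)
open import Data.List as List using (List; []; _∷_; length; map; upTo; applyUpTo; concatMap; filter; foldr; foldl; tabulate)
open import Data.List.Membership.Propositional using (lose)
open import Data.List.Membership.Propositional.Properties using (∈-allFin)
open import Data.List.Properties using (map-applyUpTo; map-tabulate; map-∘; map-++)
open import Data.List.Relation.Unary.All as All using (All; []; _∷_)
open import Data.List.Relation.Unary.All.Properties using (all⁺; all⁻)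
open import Data.List.Relation.Unary.Any using (satisfied)
open import Data.List.Relation.Unary.Any.Properties using (any⁺; any⁻)
open import Data.Nat as ℕ using (ℕ; zero; suc; _∸_; _≡ᵇ_; _<ᵇ_; _<_; _≤_; s≤s; z≤n; z<s; s<s)
open import Data.Nat.Divisibility using (n∣m*n)
open import Data.Nat.DivMod using (_%_; m*n/n≡m; m*n%n≡0; [m+kn]%n≡m%n; +-distrib-/-∣ʳ)
import Data.Nat.Properties as ℕₚ
open import Data.Product using (_×_; _,_; proj₁; proj₂; ∃)
open import Data.Sum using (_⊎_; inj₁; inj₂)
open import Data.Unit using (tt)
open import Data.Vec using (Vec; []; _∷_; lookup)
open import Function using (_∘_; case_of_)
open import Function.Bundles using (Equivalence)
open import Relation.Binary using (tri<; tri≈; tri>)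
open import Relation.Binary.PropositionalEquality as ≡ using (_≡_; _≢_)
open import Relation.Nullary using (¬_; contradiction; yes; no)
open import Relation.Nullary.Decidable using (toWitness; fromWitness)

-- The recursion closes on the set `H` of low values found in the suffix, not on its size: an even
-- index that is not fixed consumes an element of `H`. Only once the weights are known to depend on
-- the size k of `H` alone can the sum over the consumed element be carried out. It then yields the
-- shape x + (k - 1) u: among the k candidates below p just the least is an antirecord. In the same
-- way, among the candidates above p just the greatest missing value is a record.
--
-- Fixed points need neither kind of candidate. For k > 0 their weight w is added to the non-fixed
-- choices that keep the number of arcs, which is why w enters the even coefficients only. For k = 0
-- an odd fixed point forces the next index to be fixed too, both are record-antirecords, and the
-- pair gives δ₁.
--
-- Two half-steps move k by at most one, so the recursion has three terms, like the even contraction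
-- of the T-fraction. The weights do not match literally: here rises and falls both carry weight,
-- whereas the paths of the fraction rise for free. Only the product over a rise and the matching
-- fall agrees, and a rescaling by the rises closes the gap.

module Words where

  open import Data.Nat using (_+_)
  open import Data.Nat.Properties
  open import Relation.Binary.PropositionalEquality
  open Equivalence using (to; from)

  bool-ext : ∀ {a b} → (T a → T b) → (T b → T a) → a ≡ b
  bool-ext {false} {false} f g = refl
  bool-ext {false} {true}  f g = ⊥-elim (g tt)
  bool-ext {true}  {false} f g = ⊥-elim (f tt)
  bool-ext {true}  {true}  f g = refl

  ¬T⇒false : ∀ {b} → ¬ T b → b ≡ false
  ¬T⇒false {false} _ = refl
  ¬T⇒false {true}  f = ⊥-elim (f tt)

  T-not : ∀ {b} → ¬ T b → T (not b)
  T-not {false} _ = tt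
  T-not {true}  f = ⊥-elim (f tt)

  T-not⁻ : ∀ {b} → T (not b) → ¬ T b
  T-not⁻ {false} _ ()

  T⇒true : ∀ {b} → T b → b ≡ true
  T⇒true = to T-≡

  true⇒T : ∀ {b} → b ≡ true → T b
  true⇒T = from T-≡

  false⇒¬T : ∀ {b} → b ≡ false → ¬ T b
  false⇒¬T refl ()

  ∧⁻ : ∀ {a b} → T (a ∧ b) → T a × T b
  ∧⁻ = to T-∧

  ∧⁺ : ∀ {a b} → T a → T b → T (a ∧ b)
  ∧⁺ x y = from T-∧ (x , y)

  ≡ᵇ-refl : ∀ n → (n ≡ᵇ n) ≡ true
  ≡ᵇ-refl n = T⇒true (≡⇒≡ᵇ n n refl)

  ≡ᵇ-≢ : ∀ {m n} → m ≢ n → (m ≡ᵇ n) ≡ false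
  ≡ᵇ-≢ {m} {n} m≢n = ¬T⇒false (m≢n ∘ ≡ᵇ⇒≡ m n)

  <ᵇ-yes : ∀ {m n} → m < n → (m <ᵇ n) ≡ true
  <ᵇ-yes m<n = T⇒true (<⇒<ᵇ m<n)

  <ᵇ-no : ∀ {m n} → ¬ (m < n) → (m <ᵇ n) ≡ false
  <ᵇ-no {m} {n} m≮n = ¬T⇒false (m≮n ∘ <ᵇ⇒< m n)

  -- Quantifying and counting over initial segments

  allBelow : ℕ → (ℕ → Bool) → Bool
  allBelow zero    f = true
  allBelow (suc n) f = f n ∧ allBelow n f

  allBelow⁻ : ∀ n {f} → T (allBelow n f) → ∀ {b} → b < n → T (f b)
  allBelow⁻ (suc n) {f} all b<sn with m≤n⇒m<n∨m≡n (≤-pred b<sn)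
  ... | inj₁ b<n  = allBelow⁻ n (proj₂ (∧⁻ {f n} all)) b<n
  ... | inj₂ refl = proj₁ (∧⁻ all)

  allBelow⁺ : ∀ n {f} → (∀ {b} → b < n → T (f b)) → T (allBelow n f)
  allBelow⁺ zero    h = tt
  allBelow⁺ (suc n) h = ∧⁺ (h ≤-refl) (allBelow⁺ n (h ∘ m≤n⇒m≤1+n))

  allBelow-cong : ∀ n {f g} → (∀ {b} → b < n → f b ≡ g b) → allBelow n f ≡ allBelow n g
  allBelow-cong zero    h = refl
  allBelow-cong (suc n) h = cong₂ _∧_ (h ≤-refl) (allBelow-cong n (h ∘ m≤n⇒m≤1+n))

  bit : Bool → ℕ
  bit b = if b then 1 else 0

  countBelow : ℕ → (ℕ → Bool) → ℕ
  countBelow zero    f = 0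
  countBelow (suc n) f = bit (f n) + countBelow n f

  countBelow-cong : ∀ n {f g} → (∀ {b} → b < n → f b ≡ g b) → countBelow n f ≡ countBelow n g
  countBelow-cong zero    h = refl
  countBelow-cong (suc n) h = cong₂ _+_ (cong bit (h ≤-refl)) (countBelow-cong n (h ∘ m≤n⇒m≤1+n))

  countBelow-none : ∀ n → countBelow n (λ _ → false) ≡ 0
  countBelow-none zero    = refl
  countBelow-none (suc n) = countBelow-none n

  countBelow-≤ : ∀ n f → countBelow n f ≤ n
  countBelow-≤ zero    f = z≤n
  countBelow-≤ (suc n) f with f n
  ... | true  = s≤s (countBelow-≤ n f)
  ... | false = m≤n⇒m≤1+n (countBelow-≤ n f)

  countBelow-full : ∀ n f → countBelow n f ≡ n → ∀ {b} → b < n → f b ≡ true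
  countBelow-full (suc n) f eq b<sn with f n in fn
  ... | false = contradiction (subst (_≤ n) eq (countBelow-≤ n f)) 1+n≰n
  ... | true with m≤n⇒m<n∨m≡n (≤-pred b<sn)
  ...   | inj₁ b<n  = countBelow-full n f (suc-injective eq) b<n
  ...   | inj₂ refl = fn

  countBelow-0⁻ : ∀ n f → countBelow n f ≡ 0 → ∀ {b} → b < n → f b ≡ false
  countBelow-0⁻ (suc n) f eq b<sn with f n in fn
  ... | false with m≤n⇒m<n∨m≡n (≤-pred b<sn)
  ...   | inj₁ b<n  = countBelow-0⁻ n f eq b<n
  ...   | inj₂ refl = fn

  countBelow-0⁺ : ∀ n f → (∀ {b} → b < n → f b ≡ false) → countBelow n f ≡ 0
  countBelow-0⁺ n f h = trans (countBelow-cong n h) (countBelow-none n)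

  set : ℕ → Bool → (ℕ → Bool) → ℕ → Bool
  set a c f b = if b ≡ᵇ a then c else f b

  set-here : ∀ a c f → set a c f a ≡ c
  set-here a c f rewrite ≡ᵇ-refl a = refl

  set-there : ∀ {a b} c f → b ≢ a → set a c f b ≡ f b
  set-there c f b≢a rewrite ≡ᵇ-≢ b≢a = refl

  -- Old bit on the left, new bit on the right: one equation without subtraction serves both for
  -- inserting a value and for removing one.
  countBelow-set : ∀ {a} n c f → a < n → bit (f a) + countBelow n (set a c f) ≡ bit c + countBelow n f
  countBelow-set {a} (suc n) c f a<sn with m≤n⇒m<n∨m≡n (≤-pred a<sn)
  ... | inj₂ refl rewrite set-here n c f
    | countBelow-cong n {set n c f} {f} (λ b<n → set-there c f (<⇒≢ b<n))
    = trans (sym (+-assoc (bit (f n)) (bit c) _))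
        (trans (cong (_+ countBelow n f) (+-comm (bit (f n)) (bit c))) (+-assoc (bit c) _ _))
  ... | inj₁ a<n rewrite set-there c f (>⇒≢ a<n) =
    trans (swap (bit (f a)) (bit (f n)) _) (trans (cong (bit (f n) +_) (countBelow-set n c f a<n)) (swap (bit (f n)) (bit c) _))
    where
    swap : ∀ x y z → x + (y + z) ≡ y + (x + z)
    swap x y z = trans (sym (+-assoc x y z)) (trans (cong (_+ z) (+-comm x y)) (+-assoc y x z))

  -- In the window from q to m + q the hits and the misses together number m. The additive form
  -- spares the pigeonhole argument any truncated subtraction.
  countBelow-split : ∀ q m h → countBelow (m + q) h + countBelow m (λ j → not (h (j + q))) ≡ countBelow q h + m
  countBelow-split q zero    h = refl
  countBelow-split q (suc m) h with h (m + q)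
  ... | true  = trans (cong suc (countBelow-split q m h)) (sym (+-suc _ m))
  ... | false = trans (+-suc _ _) (trans (cong suc (countBelow-split q m h)) (sym (+-suc _ m)))

  -- Words of naturals: occurrence, records, antirecords

  mem : List ℕ → ℕ → Bool
  mem []      = λ _ → false
  mem (a ∷ v) = set a true (mem v)

  distinct : List ℕ → Bool
  distinct []      = true
  distinct (a ∷ v) = not (mem v a) ∧ distinct v

  countBelow-mem : ∀ {N} v → T (distinct v) → All (_< N) v → countBelow N (mem v) ≡ length v
  countBelow-mem {N} []      _ _           = countBelow-none N
  countBelow-mem {N} (a ∷ v) d (a<N ∷ v<N) with ∧⁻ {not (mem v a)} d
  ... | a∉v , dv = begin
    countBelow N (mem (a ∷ v))                  ≡⟨ cong (λ m → bit m + countBelow N (mem (a ∷ v))) (¬T⇒false (T-not⁻ a∉v)) ⟨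
    bit (mem v a) + countBelow N (mem (a ∷ v))  ≡⟨ countBelow-set N true (mem v) a<N ⟩
    suc (countBelow N (mem v))                  ≡⟨ cong suc (countBelow-mem v dv v<N) ⟩
    length (a ∷ v)                              ∎
    where open ≡-Reasoning

  mem-there : ∀ x v {b} → T (mem v b) → T (mem (x ∷ v) b)
  mem-there x v {b} m with b ≡ᵇ x
  ... | true  = tt
  ... | false = m

  anti : ℕ → List ℕ → Bool
  anti a []      = true
  anti a (b ∷ v) = (a <ᵇ b) ∧ anti a v

  anti⁻ : ∀ {a} v → T (anti a v) → ∀ {b} → T (mem v b) → a < b
  anti⁻ {a} (x ∷ v) h {b} m with b ≡ᵇ x in eq
  ... | true rewrite ≡ᵇ⇒≡ b x (true⇒T eq) = <ᵇ⇒< a x (proj₁ (∧⁻ h))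
  ... | false = anti⁻ v (proj₂ (∧⁻ {a <ᵇ x} h)) m

  anti⁺ : ∀ {a} v → (∀ {b} → T (mem v b) → a < b) → T (anti a v)
  anti⁺ []      h = tt
  anti⁺ {a} (x ∷ v) h = ∧⁺ (<⇒<ᵇ (h (true⇒T (set-here x true (mem v))))) (anti⁺ v (h ∘ mem-there x v))

  rec : ℕ → ℕ → List ℕ → Bool
  rec N a v = allBelow N (λ b → mem v b ∨ not (a <ᵇ b))

  rec⁻ : ∀ {N a} v → T (rec N a v) → ∀ {b} → b < N → a < b → mem v b ≡ true
  rec⁻ {N} {a} v r {b} b<N a<b with mem v b | allBelow⁻ N r b<N
  ... | true  | _ = refl
  ... | false | h = ⊥-elim (T-not⁻ h (<⇒<ᵇ a<b))

  rec⁺ : ∀ {N a} v → (∀ {b} → b < N → a < b → mem v b ≡ true) → T (rec N a v)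
  rec⁺ {N} {a} v h = allBelow⁺ N λ {b} b<N → step b b<N
    where
    step : ∀ b → b < N → T (mem v b ∨ not (a <ᵇ b))
    step b b<N with mem v b | h {b} b<N
    ... | true  | _ = tt
    ... | false | h = T-not λ t → contradiction (h (<ᵇ⇒< a b t)) λ ()

  -- A suffix v of a permutation of [0,N), occupying the positions above p.
  record Suffix (N M p : ℕ) (v : List ℕ) : Set where
    field
      size    : M + suc p ≡ N
      len     : length v ≡ M
      unique  : T (distinct v)
      bounded : All (_< N) v

  -- The pigeonhole principle at one position

  module _ {N M p v} (s : Suffix N M p v) where
    open Suffix s

    private
      above<N : ∀ {j} → j < M → j + suc p < N
      above<N j<M = subst (_ <_) size (+-monoˡ-< (suc p) j<M)

    -- Both sides complete the number of suffix values above p to M: the suffix has M distinct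
    -- letters, and exactly M values exceed p.
    countBelow-missing : countBelow M (λ j → not (mem v (j + suc p))) ≡ countBelow (suc p) (mem v)
    countBelow-missing = +-cancelˡ-≡ M _ _ (begin
      M + countBelow M (λ j → not (mem v (j + suc p)))
        ≡⟨ cong (_+ countBelow M (λ j → not (mem v (j + suc p))))
             (trans (cong (λ N → countBelow N (mem v)) size) (trans (countBelow-mem v unique bounded) len)) ⟨
      countBelow (M + suc p) (mem v) + countBelow M (λ j → not (mem v (j + suc p)))
        ≡⟨ countBelow-split (suc p) M (mem v) ⟩
      countBelow (suc p) (mem v) + M
        ≡⟨ +-comm _ M ⟩
      M + countBelow (suc p) (mem v) ∎)
      where open ≡-Reasoning

    -- A record at or below p puts all M values above p into the suffix, which fills it and leaves
    -- no room for a smaller value.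
    rec⇒none-low : ∀ {a} → a ≤ p → T (rec N a v) → countBelow (suc p) (mem v) ≡ 0
    rec⇒none-low a≤p r = trans (sym countBelow-missing) (countBelow-0⁺ M _ λ {j} j<M →
      cong not (rec⁻ v r (above<N j<M) (≤-<-trans a≤p (m≤n+m (suc p) j))))

    none-low⇒rec : countBelow (suc p) (mem v) ≡ 0 → T (rec N p v)
    none-low⇒rec none = rec⁺ v λ {b} b<N p<b →
      subst (λ b → mem v b ≡ true) (m∸n+n≡m p<b)
        (not-false (countBelow-0⁻ M _ (trans countBelow-missing none)
          (+-cancelʳ-< (suc p) _ _ (subst₂ _<_ (sym (m∸n+n≡m p<b)) (sym size) b<N))))
      where
      not-false : ∀ {b} → not b ≡ false → b ≡ true
      not-false {true} _ = refl

    -- A record below p would force p itself into the suffix, where `rec⇒none-low` tolerates no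
    -- value up to p. So letters below the diagonal are never records.
    rec-lower : ∀ {a} → a < p → rec N a v ≡ false
    rec-lower {a} a<p = ¬T⇒false λ r → contradiction
      (trans (sym (rec⁻ v r p<N a<p)) (countBelow-0⁻ (suc p) (mem v) (rec⇒none-low (<⇒≤ a<p) r) ≤-refl)) λ ()
      where
      p<N : p < N
      p<N = subst (p <_) size (m≤n+m (suc p) M)

    anti⇒none-low : ∀ {a} → p ≤ a → T (anti a v) → countBelow (suc p) (mem v) ≡ 0
    anti⇒none-low {a} p≤a t = countBelow-0⁺ (suc p) (mem v) λ {b} b≤p →
      ¬T⇒false λ m → <⇒≱ (anti⁻ v t m) (≤-trans (≤-pred b≤p) p≤a)

    none-low⇒anti : countBelow (suc p) (mem v) ≡ 0 → T (anti p v)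
    none-low⇒anti none = anti⁺ v λ {b} m → ≰⇒> λ b≤p →
      false⇒¬T (countBelow-0⁻ (suc p) (mem v) none (s≤s b≤p)) m

    -- An antirecord above p makes every suffix value exceed p, so by counting no value above p is
    -- missing; but the letter itself is missing.
    anti-upper : ∀ {j} → j < M → mem v (j + suc p) ≡ false → anti (j + suc p) v ≡ false
    anti-upper {j} j<M m = ¬T⇒false λ t → contradiction
      (trans (sym (cong not m)) (countBelow-0⁻ M _ (trans countBelow-missing (anti⇒none-low p≤j+ t)) j<M)) λ ()
      where
      p≤j+ : p ≤ j + suc p
      p≤j+ = ≤-trans (n≤1+n p) (m≤n+m (suc p) j)

    -- Together with `anti-fix`: a fixed point is a record exactly when it is an antirecord, so it
    -- is never exclusive and only the variables w and z can occur at it.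
    rec-fix : rec N p v ≡ (countBelow (suc p) (mem v) ≡ᵇ 0)
    rec-fix = bool-ext (≡⇒≡ᵇ _ 0 ∘ rec⇒none-low ≤-refl) (none-low⇒rec ∘ ≡ᵇ⇒≡ _ 0)

    anti-fix : anti p v ≡ (countBelow (suc p) (mem v) ≡ᵇ 0)
    anti-fix = bool-ext (≡⇒≡ᵇ _ 0 ∘ anti⇒none-low ≤-refl) (none-low⇒anti ∘ ≡ᵇ⇒≡ _ 0)

  -- The record condition in the coordinate j of the value j + suc p. Among the missing values it
  -- singles out the greatest.
  last : ℕ → (ℕ → Bool) → ℕ → Bool
  last M m j = allBelow M (λ i → m i ∨ not (j <ᵇ i))

  rec-upper : ∀ {N M p} v → M + suc p ≡ N → ∀ j → rec N (j + suc p) v ≡ last M (λ i → mem v (i + suc p)) j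
  rec-upper {N} {M} {p} v refl j = bool-ext
    (λ r → allBelow⁺ M λ {i} i<M → step i (allBelow⁻ N r (+-monoˡ-< (suc p) i<M)))
    (λ l → rec⁺ v λ {b} b<N j+<b → up l b b<N j+<b)
    where
    step : ∀ i → T (mem v (i + suc p) ∨ not (j + suc p <ᵇ i + suc p)) → T (mem v (i + suc p) ∨ not (j <ᵇ i))
    step i h with mem v (i + suc p)
    ... | true  = tt
    ... | false = T-not λ j<i → T-not⁻ h (<⇒<ᵇ (+-monoˡ-< (suc p) (<ᵇ⇒< j i j<i)))
    up : T (last M (λ i → mem v (i + suc p)) j) → ∀ b → b < N → j + suc p < b → mem v b ≡ true
    up l b b<N j+<b with m∸n+n≡m {b} {suc p} (≤-trans (m≤n+m (suc p) j) (<⇒≤ j+<b))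
    ... | eq with subst (_< N) (sym eq) b<N | subst (j + suc p <_) (sym eq) j+<b
    ...   | i+<N | j+<i+ with allBelow⁻ M l (+-cancelʳ-< (suc p) (b ∸ suc p) M i+<N)
    ...     | h = subst (λ b → mem v b ≡ true) eq (look h)
      where
      look : T (mem v (b ∸ suc p + suc p) ∨ not (j <ᵇ b ∸ suc p)) → mem v (b ∸ suc p + suc p) ≡ true
      look h with mem v (b ∸ suc p + suc p)
      ... | true  = refl
      ... | false = ⊥-elim (T-not⁻ h (<⇒<ᵇ (+-cancelʳ-< (suc p) j (b ∸ suc p) j+<i+)))

  -- Suffixes with a prescribed set of low values

  eqB : Bool → Bool → Bool
  eqB true  b = b
  eqB false b = not b

  eqB⁻ : ∀ {a b} → T (eqB a b) → a ≡ b
  eqB⁻ {true}  {true}  _ = refl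
  eqB⁻ {false} {false} _ = refl

  eqB⁺ : ∀ {a b} → a ≡ b → T (eqB a b)
  eqB⁺ {true}  refl = tt
  eqB⁺ {false} refl = tt

  match : ℕ → (ℕ → Bool) → List ℕ → Bool
  match p H v = allBelow p (λ b → eqB (mem v b) (H b))

  match⁻ : ∀ p {H} v → T (match p H v) → ∀ {b} → b < p → mem v b ≡ H b
  match⁻ p v t b<p = eqB⁻ (allBelow⁻ p t b<p)

  match⁺ : ∀ p {H} v → (∀ {b} → b < p → mem v b ≡ H b) → T (match p H v)
  match⁺ p v h = allBelow⁺ p (λ b<p → eqB⁺ (h b<p))

  match-count : ∀ p {H} v → T (match p H v) → countBelow p (mem v) ≡ countBelow p H
  match-count p v t = countBelow-cong p (match⁻ p v t)

  match-set : ∀ p c H v → match (suc p) (set p c H) v ≡ eqB (mem v p) c ∧ match p H v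
  match-set p c H v = cong₂ _∧_ (cong (eqB (mem v p)) (set-here p c H))
    (allBelow-cong p λ b<p → cong (eqB (mem v _)) (set-there c H (<⇒≢ b<p)))

  countBelow-set-top : ∀ p c H → countBelow (suc p) (set p c H) ≡ bit c + countBelow p H
  countBelow-set-top p c H = cong₂ _+_ (cong bit (set-here p c H))
    (countBelow-cong p λ b<p → set-there c H (<⇒≢ b<p))

  match-upper : ∀ p H {a} v → p ≤ a → match p H (a ∷ v) ≡ match p H v
  match-upper p H v p≤a = allBelow-cong p λ b<p →
    cong (λ m → eqB m _) (set-there true (mem v) (<⇒≢ (<-≤-trans b<p p≤a)))

  -- Putting a in front turns the state `set a false H` into `H`, so `H` must select a. The cleared
  -- bit at a is precisely the requirement that a be new to v.
  match-lower : ∀ p H {a} v → a < p →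
    not (mem v a) ∧ match p H (a ∷ v) ≡ H a ∧ match p (set a false H) v
  match-lower p H {a} v a<p = bool-ext f g
    where
    f : T (not (mem v a) ∧ match p H (a ∷ v)) → T (H a ∧ match p (set a false H) v)
    f t with ∧⁻ {not (mem v a)} t
    ... | a∉v , m = ∧⁺ (true⇒T (trans (sym (match⁻ p (a ∷ v) m a<p)) (set-here a true (mem v))))
                       (match⁺ p v λ {b} → agree b)
      where
      agree : ∀ b → b < p → mem v b ≡ set a false H b
      agree b b<p with b ≡ᵇ a in eq | match⁻ p (a ∷ v) m b<p
      ... | true  | _ rewrite ≡ᵇ⇒≡ b a (true⇒T eq) = ¬T⇒false (T-not⁻ a∉v)
      ... | false | h = h
    g : T (H a ∧ match p (set a false H) v) → T (not (mem v a) ∧ match p H (a ∷ v))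
    g t with ∧⁻ {H a} t
    ... | Ha , m = ∧⁺ (T-not (false⇒¬T (trans (match⁻ p v m a<p) (set-here a false H))))
                      (match⁺ p (a ∷ v) λ {b} → agree b)
      where
      agree : ∀ b → b < p → mem (a ∷ v) b ≡ H b
      agree b b<p with b ≡ᵇ a in eq | match⁻ p v m b<p
      ... | true  | _ rewrite ≡ᵇ⇒≡ b a (true⇒T eq) = sym (T⇒true Ha)
      ... | false | h = h

  first : ℕ → (ℕ → Bool) → Bool
  first a H = allBelow a (λ b → not (H b))

  -- Only values up to a can prevent an antirecord, and below p the suffix is known to be `H`
  -- without a. Hence the condition depends on `H` and not on v.
  anti-lower : ∀ p H {a} v → a < p → T (match p (set a false H) v) → anti a v ≡ first a H
  anti-lower p H {a} v a<p m = bool-ext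
    (λ t → allBelow⁺ a λ b<a → T-not λ Hb →
      <-asym b<a (anti⁻ v t (true⇒T (trans (match⁻ p v m (<-trans b<a a<p)) (trans (set-there false H (<⇒≢ b<a)) (T⇒true Hb))))))
    (λ t → anti⁺ v λ {b} mb → ≰⇒> λ b≤a → low t b mb (m≤n⇒m<n∨m≡n b≤a))
    where
    low : T (first a H) → ∀ b → T (mem v b) → b < a ⊎ b ≡ a → ⊥
    low t b mb (inj₁ b<a)  = T-not⁻ (allBelow⁻ a t b<a)
      (true⇒T (trans (sym (trans (match⁻ p v m (<-trans b<a a<p)) (set-there false H (<⇒≢ b<a)))) (T⇒true mb)))
    low t b mb (inj₂ refl) = false⇒¬T (trans (match⁻ p v m a<p) (set-here a false H)) mb

  parity-suc : ∀ p → (suc p % 2 ≡ᵇ 0) ≡ not (p % 2 ≡ᵇ 0)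
  parity-suc zero          = refl
  parity-suc (suc zero)    = refl
  parity-suc (suc (suc p)) = parity-suc p

  double : ℕ → ℕ
  double zero    = zero
  double (suc n) = suc (suc (double n))

-- Statistics of a permutation read off the suffixes of its word

module Encoding where

  open import Relation.Binary.PropositionalEquality
  open Words

  module _ {m : ℕ} {p : Fin m → Bool} where

    allFin⁻ : T (Defs.allFin m p) → ∀ i → T (p i)
    allFin⁻ t i = All.lookup (all⁺ p (List.allFin m) t) (∈-allFin i)

    allFin⁺ : (∀ i → T (p i)) → T (Defs.allFin m p)
    allFin⁺ h = all⁻ p (All.universal h (List.allFin m))

    anyFin⁻ : T (anyFin m p) → ∃ λ i → T (p i)
    anyFin⁻ t = satisfied (any⁻ p (List.allFin m) t)

    anyFin⁺ : ∀ i → T (p i) → T (anyFin m p)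
    anyFin⁺ i pi = any⁺ p (lose (∈-allFin i) pi)

  ==ᵇ⁻ : ∀ {m} {i j : Fin m} → T (i Defs.==ᵇ j) → i ≡ j
  ==ᵇ⁻ {i = i} {j} = toWitness {a? = i Fin.≟ j}

  ==ᵇ⁺ : ∀ {m} {i j : Fin m} → i ≡ j → T (i Defs.==ᵇ j)
  ==ᵇ⁺ {i = i} {j} = fromWitness {a? = i Fin.≟ j}

  implies⁻ : ∀ {a b} → T (not a ∨ b) → T a → T b
  implies⁻ {true} t _ = t

  implies⁺ : ∀ {a b} → (T a → T b) → T (not a ∨ b)
  implies⁺ {true}  h = h _
  implies⁺ {false} h = _

  module _ {N : ℕ} where

    word : ∀ {m} → Vec (Fin N) m → List ℕ
    word []      = []
    word (a ∷ v) = toℕ a ∷ word v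

    suffix : ∀ {m} → Vec (Fin N) m → Fin m → List ℕ
    suffix (a ∷ v) zero    = word v
    suffix (a ∷ v) (suc i) = suffix v i

    length-word : ∀ {m} (v : Vec (Fin N) m) → length (word v) ≡ m
    length-word []      = refl
    length-word (a ∷ v) = cong suc (length-word v)

    length-suffix : ∀ {m} (v : Vec (Fin N) m) i → length (suffix v i) ≡ m ∸ suc (toℕ i)
    length-suffix (a ∷ v) zero    = length-word v
    length-suffix (a ∷ v) (suc i) = length-suffix v i

    word-bounded : ∀ {m} (v : Vec (Fin N) m) → All (_< N) (word v)
    word-bounded []      = []
    word-bounded (a ∷ v) = toℕ<n a ∷ word-bounded v

    mem-word⁻ : ∀ {m} (v : Vec (Fin N) m) {b} → T (mem (word v) b) → ∃ λ j → toℕ (lookup v j) ≡ b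
    mem-word⁻ (a ∷ v) {b} t with b ≡ᵇ toℕ a in eq
    ... | true  = zero , sym (ℕₚ.≡ᵇ⇒≡ b (toℕ a) (true⇒T eq))
    ... | false = case mem-word⁻ v t of λ { (j , e) → suc j , e }

    mem-word⁺ : ∀ {m} (v : Vec (Fin N) m) j → T (mem (word v) (toℕ (lookup v j)))
    mem-word⁺ (a ∷ v) zero    = true⇒T (set-here (toℕ a) true (mem (word v)))
    mem-word⁺ (a ∷ v) (suc j) = mem-there (toℕ a) (word v) (mem-word⁺ v j)

    mem-suffix⁻ : ∀ {m} (v : Vec (Fin N) m) i {b} → T (mem (suffix v i) b) →
      ∃ λ j → toℕ i < toℕ j × toℕ (lookup v j) ≡ b
    mem-suffix⁻ (a ∷ v) zero    t = case mem-word⁻ v t of λ { (j , e) → suc j , z<s , e }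
    mem-suffix⁻ (a ∷ v) (suc i) t = case mem-suffix⁻ v i t of λ { (j , i<j , e) → suc j , s<s i<j , e }

    mem-suffix⁺ : ∀ {m} (v : Vec (Fin N) m) i j → toℕ i < toℕ j → T (mem (suffix v i) (toℕ (lookup v j)))
    mem-suffix⁺ (a ∷ v) zero    (suc j) _         = mem-word⁺ v j
    mem-suffix⁺ (a ∷ v) (suc i) (suc j) (s≤s i<j) = mem-suffix⁺ v i j i<j

    distinct-word⁻ : ∀ {m} (v : Vec (Fin N) m) → T (distinct (word v)) → ∀ i j → lookup v i ≡ lookup v j → i ≡ j
    distinct-word⁻ (a ∷ v) d zero    zero    e = refl
    distinct-word⁻ (a ∷ v) d zero    (suc j) e = contradiction
      (subst (λ b → T (mem (word v) (toℕ b))) (sym e) (mem-word⁺ v j)) (T-not⁻ (proj₁ (∧⁻ {not (mem (word v) (toℕ a))} d)))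
    distinct-word⁻ (a ∷ v) d (suc i) zero    e = contradiction
      (subst (λ b → T (mem (word v) (toℕ b))) e (mem-word⁺ v i)) (T-not⁻ (proj₁ (∧⁻ {not (mem (word v) (toℕ a))} d)))
    distinct-word⁻ (a ∷ v) d (suc i) (suc j) e =
      cong suc (distinct-word⁻ v (proj₂ (∧⁻ {not (mem (word v) (toℕ a))} d)) i j e)

    distinct-word⁺ : ∀ {m} (v : Vec (Fin N) m) → (∀ i j → lookup v i ≡ lookup v j → i ≡ j) → T (distinct (word v))
    distinct-word⁺ []      inj = _
    distinct-word⁺ (a ∷ v) inj = ∧⁺
      (T-not λ t → case mem-word⁻ v t of λ { (j , e) → case inj zero (suc j) (sym (toℕ-injective e)) of λ () })
      (distinct-word⁺ v λ i j e → suc-inj (inj (suc i) (suc j) e))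
      where
      suc-inj : ∀ {n} {i j : Fin n} → Fin.suc i ≡ suc j → i ≡ j
      suc-inj refl = refl

  module _ {N : ℕ} (σ : Map N) where

    isPerm-distinct : isPerm σ ≡ distinct (word σ)
    isPerm-distinct = bool-ext
      (λ t → distinct-word⁺ σ λ i j e → ==ᵇ⁻ (implies⁻ (allFin⁻ (allFin⁻ t i) j) (==ᵇ⁺ e)))
      (λ d → allFin⁺ λ i → allFin⁺ λ j → implies⁺ λ e → ==ᵇ⁺ (distinct-word⁻ σ d i j (==ᵇ⁻ e)))

    isAntirecord-anti : ∀ i → isAntirecord σ i ≡ anti (toℕ (lookup σ i)) (suffix σ i)
    isAntirecord-anti i = bool-ext
      (λ t → anti⁺ (suffix σ i) λ m → case mem-suffix⁻ σ i m of λ { (j , i<j , refl) →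
        ℕₚ.<ᵇ⇒< _ _ (implies⁻ (allFin⁻ t j) (ℕₚ.<⇒<ᵇ i<j)) })
      (λ t → allFin⁺ λ j → implies⁺ λ i<j → ℕₚ.<⇒<ᵇ (anti⁻ (suffix σ i) t (mem-suffix⁺ σ i j (ℕₚ.<ᵇ⇒< (toℕ i) _ i<j))))

    preGreater-mem : ∀ i → preGreater σ i ≡ mem (suffix σ i) (toℕ i)
    preGreater-mem i = bool-ext
      (λ t → case anyFin⁻ t of λ { (j , tj) → case ∧⁻ {app σ j Defs.==ᵇ i} tj of λ { (e , i<j) →
        subst (λ b → T (mem (suffix σ i) (toℕ b))) (==ᵇ⁻ e) (mem-suffix⁺ σ i j (ℕₚ.<ᵇ⇒< (toℕ i) _ i<j)) } })
      (λ m → case mem-suffix⁻ σ i m of λ { (j , i<j , e) → anyFin⁺ j (∧⁺ (==ᵇ⁺ (toℕ-injective e)) (ℕₚ.<⇒<ᵇ i<j)) })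

    fixpt-≡ᵇ : ∀ i → fixpt σ i ≡ (toℕ (lookup σ i) ≡ᵇ toℕ i)
    fixpt-≡ᵇ i = bool-ext (λ t → ℕₚ.≡⇒≡ᵇ _ _ (cong toℕ (==ᵇ⁻ t))) (λ t → ==ᵇ⁺ (toℕ-injective (ℕₚ.≡ᵇ⇒≡ _ _ t)))

    module _ (perm : T (isPerm σ)) where

      private
        d : T (distinct (word σ))
        d = subst T isPerm-distinct perm

        inj : ∀ {i j} → toℕ (lookup σ i) ≡ toℕ (lookup σ j) → i ≡ j
        inj e = distinct-word⁻ σ d _ _ (toℕ-injective e)

      -- N distinct letters below N exhaust the values below N.
      surjective : ∀ {b} → b < N → ∃ λ j → toℕ (lookup σ j) ≡ b
      surjective b<N = mem-word⁻ σ (true⇒T (countBelow-full N (mem (word σ))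
        (trans (countBelow-mem (word σ) d (word-bounded σ)) (length-word σ)) b<N))

      -- Surjectivity places each larger value somewhere, and a record pushes that place to the
      -- right of i. Conversely, by injectivity a larger value found on the right cannot also sit on
      -- the left.
      isRecord-rec : ∀ i → isRecord σ i ≡ rec N (toℕ (lookup σ i)) (suffix σ i)
      isRecord-rec i = bool-ext
        (λ t → rec⁺ (suffix σ i) λ b<N a<b → case surjective b<N of λ { (j , refl) → later t j a<b })
        (λ r → allFin⁺ λ j → implies⁺ λ j<i → ℕₚ.<⇒<ᵇ (below r j (ℕₚ.<ᵇ⇒< (toℕ j) _ j<i)))
        where
        later : T (isRecord σ i) → ∀ j → toℕ (lookup σ i) < toℕ (lookup σ j) → mem (suffix σ i) (toℕ (lookup σ j)) ≡ true
        later t j a<b with ℕₚ.<-cmp (toℕ i) (toℕ j)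
        ... | tri< i<j _ _ = T⇒true (mem-suffix⁺ σ i j i<j)
        ... | tri≈ _ i≡j _ = contradiction (subst (λ j → toℕ (lookup σ i) < toℕ (lookup σ j)) (sym (toℕ-injective i≡j)) a<b) (ℕₚ.n≮n _)
        ... | tri> _ _ j<i = contradiction (ℕₚ.<ᵇ⇒< _ _ (implies⁻ (allFin⁻ t j) (ℕₚ.<⇒<ᵇ j<i))) (ℕₚ.<-asym a<b)
        below : T (rec N (toℕ (lookup σ i)) (suffix σ i)) → ∀ j → toℕ j < toℕ i → toℕ (lookup σ j) < toℕ (lookup σ i)
        below r j j<i with ℕₚ.<-cmp (toℕ (lookup σ j)) (toℕ (lookup σ i))
        ... | tri< b<a _ _ = b<a
        ... | tri≈ _ b≡a _ = contradiction (cong toℕ (inj b≡a)) (ℕₚ.<⇒≢ j<i)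
        ... | tri> _ _ a<b = case mem-suffix⁻ σ i (true⇒T (rec⁻ (suffix σ i) r (toℕ<n _) a<b)) of λ { (j′ , i<j′ , e) →
          contradiction (subst (λ j → toℕ i < toℕ j) (inj e) i<j′) (ℕₚ.<-asym j<i) }

      -- A preimage exists, so it lies strictly to the left exactly when it is neither i nor to the
      -- right. Prepending the letter at i to the suffix rules out the fixed point.
      preLess-mem : ∀ i → preLess σ i ≡ not (mem (toℕ (lookup σ i) ∷ suffix σ i) (toℕ i))
      preLess-mem i = bool-ext
        (λ t → case anyFin⁻ t of λ { (j , tj) → case ∧⁻ {app σ j Defs.==ᵇ i} tj of λ { (e , j<i) →
          T-not (absent j (==ᵇ⁻ e) (ℕₚ.<ᵇ⇒< _ (toℕ i) j<i)) } })
        (λ t → case surjective (toℕ<n i) of λ { (j , e) → anyFin⁺ j (∧⁺ (==ᵇ⁺ (toℕ-injective e)) (ℕₚ.<⇒<ᵇ (earlier t j e))) })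
        where
        absent : ∀ j → lookup σ j ≡ i → toℕ j < toℕ i → ¬ T (mem (toℕ (lookup σ i) ∷ suffix σ i) (toℕ i))
        absent j e j<i t with toℕ i ≡ᵇ toℕ (lookup σ i) in eq
        ... | true  = contradiction (cong toℕ (inj (trans (cong toℕ e) (ℕₚ.≡ᵇ⇒≡ _ _ (true⇒T eq))))) (ℕₚ.<⇒≢ j<i)
        ... | false = case mem-suffix⁻ σ i t of λ { (j′ , i<j′ , e′) →
          contradiction (subst (λ j → toℕ i < toℕ j) (inj (trans e′ (cong toℕ (sym e)))) i<j′) (ℕₚ.<-asym j<i) }
        earlier : T (not (mem (toℕ (lookup σ i) ∷ suffix σ i) (toℕ i))) → ∀ j → toℕ (lookup σ j) ≡ toℕ i → toℕ j < toℕ i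
        earlier t j e with ℕₚ.<-cmp (toℕ j) (toℕ i)
        ... | tri< j<i _ _ = j<i
        ... | tri≈ _ j≡i _ = contradiction (true⇒T (trans (cong (mem (toℕ (lookup σ i) ∷ suffix σ i))
                (trans (sym e) (cong (toℕ ∘ lookup σ) (toℕ-injective j≡i))))
                (set-here (toℕ (lookup σ i)) true (mem (suffix σ i))))) (T-not⁻ t)
        ... | tri> _ _ i<j = contradiction (mem-there (toℕ (lookup σ i)) (suffix σ i)
                (subst (T ∘ mem (suffix σ i)) e (mem-suffix⁺ σ i j i<j))) (T-not⁻ t)

    -- `W` knows a position only through the number of letters to its right; for a word of full
    -- length this recovers the index.
    position : ∀ i → N ∸ suc (length (suffix σ i)) ≡ toℕ i
    position i = trans (cong (λ l → N ∸ suc l) (length-suffix σ i))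
      (trans (sym (ℕₚ.∸-+-assoc N 1 _)) (lemma N (toℕ i) (toℕ<n i)))
      where
      lemma : ∀ N p → p < N → N ∸ 1 ∸ (N ∸ suc p) ≡ p
      lemma (suc n) p (s≤s p≤n) = ℕₚ.m∸[m∸n]≡n p≤n

-- Weighted sums over suffixes and the transfer recursion

module WordSums {c ℓ : Level} (R : CommutativeRing c ℓ) where

  open CommutativeRing R hiding (zero)
  open Ring R using (_·_)
  open Words
  open import Relation.Binary.Reasoning.Setoid setoid
  open import Algebra.Properties.CommutativeSemigroup +-commutativeSemigroup using (interchange)
  open import Algebra.Solver.Ring.NaturalCoefficients.Default commutativeSemiring
    using (solve; _:=_; _:+_; _:*_)

  ∑ : ℕ → (ℕ → Carrier) → Carrier
  ∑ zero    f = 0#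
  ∑ (suc n) f = ∑ n f + f n

  ∑-cong : ∀ n {f g} → (∀ {i} → i < n → f i ≈ g i) → ∑ n f ≈ ∑ n g
  ∑-cong zero    h = refl
  ∑-cong (suc n) h = +-cong (∑-cong n (h ∘ ℕₚ.m≤n⇒m≤1+n)) (h ℕₚ.≤-refl)

  ∑-zero : ∀ n {f} → (∀ {i} → i < n → f i ≈ 0#) → ∑ n f ≈ 0#
  ∑-zero zero    h = refl
  ∑-zero (suc n) h = trans (+-cong (∑-zero n (h ∘ ℕₚ.m≤n⇒m≤1+n)) (h ℕₚ.≤-refl)) (+-identityˡ 0#)

  ∑-+ : ∀ n f g → ∑ n (λ i → f i + g i) ≈ ∑ n f + ∑ n g
  ∑-+ zero    f g = sym (+-identityˡ 0#)
  ∑-+ (suc n) f g = trans (+-congʳ (∑-+ n f g)) (interchange _ _ _ _)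

  ∑-*ʳ : ∀ n f x → ∑ n (λ i → f i * x) ≈ ∑ n f * x
  ∑-*ʳ zero    f x = sym (zeroˡ x)
  ∑-*ʳ (suc n) f x = trans (+-congʳ (∑-*ʳ n f x)) (sym (distribʳ x _ _))

  ∑-split : ∀ q m f → ∑ (m ℕ.+ q) f ≈ ∑ q f + ∑ m (λ j → f (j ℕ.+ q))
  ∑-split q zero    f = sym (+-identityʳ _)
  ∑-split q (suc m) f = trans (+-congʳ (∑-split q m f)) (+-assoc _ _ _)

  when : Bool → Carrier → Carrier
  when b x = if b then x else 0#

  when-cong : ∀ b {x y} → x ≈ y → when b x ≈ when b y
  when-cong true  x≈y = x≈y
  when-cong false x≈y = refl

  when-zero : ∀ b {x} → x ≈ 0# → when b x ≈ 0#
  when-zero true  x≈0 = x≈0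
  when-zero false x≈0 = refl

  when-*ʳ : ∀ b x y → when b (x * y) ≈ when b x * y
  when-*ʳ true  x y = refl
  when-*ʳ false x y = sym (zeroˡ y)

  when-∧ : ∀ a b x → when (a ∧ b) x ≈ when a (when b x)
  when-∧ true  b x = refl
  when-∧ false b x = refl

  ∑-when : ∀ n b f → ∑ n (λ i → when b (f i)) ≈ when b (∑ n f)
  ∑-when n true  f = refl
  ∑-when n false f = ∑-zero n (λ _ → refl)

  -- Total weight of a choice among k candidates, one of which is extremal and weighs x while every
  -- other weighs u.
  pick : Carrier → Carrier → ℕ → Carrier
  pick x u zero    = 0#
  pick x u (suc k) = x + k · u

  pick-suc : ∀ x u k → pick x u k + (if k ≡ᵇ 0 then x else u) ≈ pick x u (suc k)
  pick-suc x u zero    = +-comm 0# x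
  pick-suc x u (suc k) = trans (+-assoc _ _ _) (+-congˡ (+-comm _ u))

  first-none : ∀ n H → first n H ≡ (countBelow n H ≡ᵇ 0)
  first-none zero    H = ≡.refl
  first-none (suc n) H with H n
  ... | true  = ≡.refl
  ... | false = first-none n H

  -- A new candidate on top never changes which candidate is least, so the earlier sum persists and
  -- the new term is x only if there was no candidate before.
  ∑-first : ∀ n H x u → ∑ n (λ a → when (H a) (if first a H then x else u)) ≈ pick x u (countBelow n H)
  ∑-first zero    H x u = refl
  ∑-first (suc n) H x u with H n
  ... | false = trans (+-identityʳ _) (∑-first n H x u)
  ... | true rewrite first-none n H = trans (+-congʳ (∑-first n H x u)) (pick-suc x u (countBelow n H))

  ∑-when-const : ∀ n m v → ∑ n (λ j → when (m j) v) ≈ countBelow n m · v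
  ∑-when-const zero    m v = refl
  ∑-when-const (suc n) m v with m n
  ... | false = trans (+-identityʳ _) (∑-when-const n m v)
  ... | true  = trans (+-congʳ (∑-when-const n m v)) (+-comm _ v)

  last-top : ∀ n m → last n m n ≡ true
  last-top n m = T⇒true (allBelow⁺ n λ {i} i<n → weaken (m i) (T-not λ t → ℕₚ.<-asym i<n (ℕₚ.<ᵇ⇒< n i t)))
    where
    weaken : ∀ a {b} → T b → T (a ∨ b)
    weaken true  _ = _
    weaken false t = t

  -- Unlike in `∑-first`, a new candidate on top takes over the extremal role: all earlier ones drop
  -- to v, so that case is evaluated outright rather than by induction.
  ∑-last : ∀ n m y v → ∑ n (λ j → when (not (m j)) (if last n m j then y else v)) ≈ pick y v (countBelow n (λ j → not (m j)))
  ∑-last zero    m y v = refl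
  ∑-last (suc n) m y v with m n
  ... | true  = trans (+-identityʳ _) (∑-last n m y v)
  ... | false = begin
    ∑ n (λ j → when (not (m j)) (if not (j <ᵇ n) ∧ last n m j then y else v))
      + (if not (n <ᵇ n) ∧ last n m n then y else v)
      ≈⟨ +-cong (trans (∑-cong n λ {j} j<n → when-cong (not (m j)) (reflexive (not-last j<n)))
                       (∑-when-const n (λ j → not (m j)) v))
                (reflexive top) ⟩
    countBelow n (λ j → not (m j)) · v + y ≈⟨ +-comm _ y ⟩
    y + countBelow n (λ j → not (m j)) · v ∎
    where
    not-last : ∀ {j} → j < n → (if not (j <ᵇ n) ∧ last n m j then y else v) ≡ v
    not-last j<n rewrite <ᵇ-yes j<n = ≡.refl
    top : (if not (n <ᵇ n) ∧ last n m n then y else v) ≡ y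
    top rewrite <ᵇ-no (ℕₚ.n≮n n) | last-top n m = ≡.refl

  -- The head is summed innermost, so that a transfer step sums over one letter in front of a fixed
  -- suffix. `allVecs` enumerates in the same order.
  sumWords : ℕ → ℕ → (List ℕ → Carrier) → Carrier
  sumWords N zero    f = f []
  sumWords N (suc M) f = sumWords N M (λ v → ∑ N (λ a → f (a ∷ v)))

  sumWords-cong : ∀ N M {f g} → (∀ {v} → length v ≡ M → All (_< N) v → f v ≈ g v) → sumWords N M f ≈ sumWords N M g
  sumWords-cong N zero    h = h ≡.refl []
  sumWords-cong N (suc M) h = sumWords-cong N M λ len b → ∑-cong N λ a<N → h (≡.cong suc len) (a<N ∷ b)

  sumWords-+ : ∀ N M f g → sumWords N M (λ v → f v + g v) ≈ sumWords N M f + sumWords N M g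
  sumWords-+ N zero    f g = refl
  sumWords-+ N (suc M) f g = trans (sumWords-cong N M λ _ _ → ∑-+ N _ _) (sumWords-+ N M _ _)

  sumWords-*ʳ : ∀ N M f x → sumWords N M (λ v → f v * x) ≈ sumWords N M f * x
  sumWords-*ʳ N zero    f x = refl
  sumWords-*ʳ N (suc M) f x = trans (sumWords-cong N M λ _ _ → ∑-*ʳ N _ x) (sumWords-*ʳ N M _ x)

  sumWords-0 : ∀ N M → sumWords N M (λ _ → 0#) ≈ 0#
  sumWords-0 N zero    = refl
  sumWords-0 N (suc M) = trans (sumWords-cong N M λ _ _ → ∑-zero N (λ _ → refl)) (sumWords-0 N M)

  sumWords-∑ : ∀ N M n (f : ℕ → List ℕ → Carrier) → sumWords N M (λ v → ∑ n (λ a → f a v)) ≈ ∑ n (λ a → sumWords N M (f a))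
  sumWords-∑ N M zero    f = sumWords-0 N M
  sumWords-∑ N M (suc n) f = trans (sumWords-+ N M _ _) (+-congʳ (sumWords-∑ N M n f))

  sumWords-when : ∀ N M b f → sumWords N M (λ v → when b (f v)) ≈ when b (sumWords N M f)
  sumWords-when N M true  f = refl
  sumWords-when N M false f = sumWords-0 N M

  selProd : List (Bool × Carrier) → Carrier
  selProd []              = 1#
  selProd ((true  , x) ∷ l) = x * selProd l
  selProd ((false , x) ∷ l) = selProd l

  dcond : ℕ → ℕ → Bool
  dcond p a = if p % 2 ≡ᵇ 0 then not (a <ᵇ p) else not (p <ᵇ a)

  -- Local weights and the two half-steps

  module Weight (x₁ x₂ y₁ y₂ u₁ u₂ v₁ v₂ wₑ wₒ zₑ zₒ : Carrier) where

    -- The flags of an index i say: record, antirecord, σ⁻¹(i) < i, σ⁻¹(i) > i, σ(i) < i, σ(i) > i, σ(i) = i, i odd.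
    entries : (r t pl pg lt gt eq o : Bool) → List (Bool × Carrier)
    entries r t pl pg lt gt eq o =
        ((t ∧ not r) ∧ pl ∧ lt , x₁) ∷ ((t ∧ not r) ∧ pg ∧ lt , x₂)
      ∷ ((r ∧ not t) ∧ pg ∧ gt , y₁) ∷ ((r ∧ not t) ∧ pl ∧ gt , y₂)
      ∷ ((not r ∧ not t) ∧ pl ∧ lt , u₁) ∷ ((not r ∧ not t) ∧ pg ∧ lt , u₂)
      ∷ ((not r ∧ not t) ∧ pg ∧ gt , v₁) ∷ ((not r ∧ not t) ∧ pl ∧ gt , v₂)
      ∷ ((not r ∧ not t) ∧ eq ∧ not o , wₑ) ∷ ((not r ∧ not t) ∧ eq ∧ o , wₒ)
      ∷ ((r ∧ t) ∧ not o , zₑ) ∷ ((r ∧ t) ∧ o , zₒ) ∷ []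

    -- k is the number of values below the fixed point that occur to its right; it is a
    -- record-antirecord exactly when there are none.
    fixw : Carrier → Carrier → ℕ → Carrier
    fixw w z k = if k ≡ᵇ 0 then z else w

    -- Below, above or on the diagonal, exactly one of the twelve conditions survives, so every
    -- letter contributes a single variable.
    eval-lower : ∀ {r t pl pg lt gt eq o} → r ≡ false → pl ≡ not pg → lt ≡ true → gt ≡ false → eq ≡ false →
      selProd (entries r t pl pg lt gt eq o) ≈ (if pg then (if t then x₂ else u₂) else (if t then x₁ else u₁))
    eval-lower {t = true}  {pg = true}  ≡.refl ≡.refl ≡.refl ≡.refl ≡.refl = *-identityʳ x₂
    eval-lower {t = true}  {pg = false} ≡.refl ≡.refl ≡.refl ≡.refl ≡.refl = *-identityʳ x₁
    eval-lower {t = false} {pg = true}  ≡.refl ≡.refl ≡.refl ≡.refl ≡.refl = *-identityʳ u₂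
    eval-lower {t = false} {pg = false} ≡.refl ≡.refl ≡.refl ≡.refl ≡.refl = *-identityʳ u₁

    eval-upper : ∀ {r t pl pg lt gt eq o} → t ≡ false → pl ≡ not pg → lt ≡ false → gt ≡ true → eq ≡ false →
      selProd (entries r t pl pg lt gt eq o) ≈ (if pg then (if r then y₁ else v₁) else (if r then y₂ else v₂))
    eval-upper {r = true}  {pg = true}  ≡.refl ≡.refl ≡.refl ≡.refl ≡.refl = *-identityʳ y₁
    eval-upper {r = true}  {pg = false} ≡.refl ≡.refl ≡.refl ≡.refl ≡.refl = *-identityʳ y₂
    eval-upper {r = false} {pg = true}  ≡.refl ≡.refl ≡.refl ≡.refl ≡.refl = *-identityʳ v₁
    eval-upper {r = false} {pg = false} ≡.refl ≡.refl ≡.refl ≡.refl ≡.refl = *-identityʳ v₂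

    eval-fix : ∀ {r t pl pg lt gt eq o e} → r ≡ e → t ≡ e → lt ≡ false → gt ≡ false → eq ≡ true → pl ≡ false → pg ≡ false →
      selProd (entries r t pl pg lt gt eq o) ≈ (if o then (if e then zₒ else wₒ) else (if e then zₑ else wₑ))
    eval-fix {o = true}  {true}  ≡.refl ≡.refl ≡.refl ≡.refl ≡.refl ≡.refl ≡.refl = *-identityʳ zₒ
    eval-fix {o = true}  {false} ≡.refl ≡.refl ≡.refl ≡.refl ≡.refl ≡.refl ≡.refl = *-identityʳ wₒ
    eval-fix {o = false} {true}  ≡.refl ≡.refl ≡.refl ≡.refl ≡.refl ≡.refl ≡.refl = *-identityʳ zₑ
    eval-fix {o = false} {false} ≡.refl ≡.refl ≡.refl ≡.refl ≡.refl ≡.refl ≡.refl = *-identityʳ wₑ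

    head : ℕ → ℕ → ℕ → List ℕ → Carrier
    head N p a v = selProd (entries (rec N a v) (anti a v) (not (mem (a ∷ v) p)) (mem v p)
                                    (a <ᵇ p) (p <ᵇ a) (a ≡ᵇ p) (p % 2 ≡ᵇ 0))

    allowed : ℕ → ℕ → List ℕ → Bool
    allowed p a v = not (mem v a) ∧ dcond p a

    -- Words are read as suffixes of a permutation of [0,N): the head of a ∷ v sits at position p.
    W : ℕ → List ℕ → Carrier
    W N []      = 1#
    W N (a ∷ v) = when (allowed p a v) (head N p a v * W N v)
      where p = N ∸ suc (length v)

    -- The factor `allowed` kills a repeated letter. Sums over all words thus reduce to distinct
    -- ones, and the transfer identities need a proof only for a genuine `Suffix`.
    W-repeat : ∀ N v → distinct v ≡ false → W N v ≈ 0#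
    W-repeat N (a ∷ v) d with mem v a
    ... | true  = refl
    ... | false = when-zero (dcond (N ∸ suc (length v)) a) (trans (*-congˡ (W-repeat N v d)) (zeroʳ _))

    -- Weights of the completions of a partial permutation with k open arcs and 2n
    -- (resp. 2n+1) remaining indices.
    evenSum oddSum : ℕ → ℕ → Carrier
    evenSum zero    zero    = 1#
    evenSum zero    (suc k) = 0#
    evenSum (suc n) k       = oddSum n (suc k) * pick y₁ v₁ (suc k) + oddSum n k * (pick y₂ v₂ k + fixw wₒ zₒ k)
    -- At k = 0 the truncated `k ∸ 1` does no harm, because `pick x₁ u₁ 0` is zero.
    oddSum n k = evenSum n (k ∸ 1) * pick x₁ u₁ k + evenSum n k * (pick x₂ u₂ k + fixw wₑ zₑ k)

    module _ {N M p v} (s : Suffix N M p v) where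
      open Suffix s

      pos : N ∸ suc (length v) ≡ p
      pos rewrite len | ≡.sym size | ℕₚ.+-suc M p = ℕₚ.m+n∸m≡n M p

      head-lower : ∀ {a} → a < p →
        head N p a v ≈ (if mem v p then (if anti a v then x₂ else u₂) else (if anti a v then x₁ else u₁))
      head-lower {a} a<p = eval-lower (rec-lower s a<p)
        (≡.cong not (set-there true (mem v) (ℕₚ.>⇒≢ a<p))) (<ᵇ-yes a<p) (<ᵇ-no (ℕₚ.<-asym a<p)) (≡ᵇ-≢ (ℕₚ.<⇒≢ a<p))

      head-upper : ∀ {j} → j < M → mem v (j ℕ.+ suc p) ≡ false → let l = last M (λ i → mem v (i ℕ.+ suc p)) j in
        head N p (j ℕ.+ suc p) v ≈ (if mem v p then (if l then y₁ else v₁) else (if l then y₂ else v₂))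
      head-upper {j} j<M m rewrite rec-upper v size j = eval-upper (anti-upper s j<M m)
        (≡.cong not (set-there true (mem v) (ℕₚ.<⇒≢ p<a))) (<ᵇ-no (ℕₚ.<-asym p<a)) (<ᵇ-yes p<a) (≡ᵇ-≢ (ℕₚ.>⇒≢ p<a))
        where
        p<a : p < j ℕ.+ suc p
        p<a = ℕₚ.m≤n+m (suc p) j

      head-fix : mem v p ≡ false → let k = countBelow p (mem v) in
        head N p p v ≈ (if p % 2 ≡ᵇ 0 then fixw wₒ zₒ k else fixw wₑ zₑ k)
      head-fix m = eval-fix (none (rec-fix s)) (none (anti-fix s)) (<ᵇ-no (ℕₚ.n≮n p)) (<ᵇ-no (ℕₚ.n≮n p)) (≡ᵇ-refl p)
        (≡.cong not (set-here p true (mem v))) m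
        where
        none : ∀ {b} → b ≡ (countBelow (suc p) (mem v) ≡ᵇ 0) → b ≡ (countBelow p (mem v) ≡ᵇ 0)
        none {b} = ≡.subst (λ c → b ≡ (bit c ℕ.+ countBelow p (mem v) ≡ᵇ 0)) m

      W-step : ∀ a → W N (a ∷ v) ≈ when (allowed p a v) (head N p a v) * W N v
      W-step a rewrite pos = when-*ʳ (allowed p a v) _ _

      dcond-upper : (p % 2 ≡ᵇ 0) ≡ true → ∀ a → dcond p a ≡ not (a <ᵇ p)
      dcond-upper o a rewrite o = ≡.refl

      dcond-lower : (p % 2 ≡ᵇ 0) ≡ false → ∀ a → dcond p a ≡ not (p <ᵇ a)
      dcond-lower o a rewrite o = ≡.refl

      allowed-false : ∀ {a} → dcond p a ≡ false → ∀ x → when (allowed p a v) x ≈ 0#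
      allowed-false {a} d x rewrite d | ∧-zeroʳ (not (mem v a)) = refl

      allowed-true : ∀ {a} → dcond p a ≡ true → ∀ x → when (allowed p a v) x ≈ when (not (mem v a)) x
      allowed-true {a} d x rewrite d | ∧-identityʳ (not (mem v a)) = refl

      -- If p occurs in the suffix, then suc k values up to p do, so suc k values above p are
      -- missing: the choices for a cycle valley. Otherwise k values are missing, the choices for a
      -- cycle double rise, and the fixed point is available as well.
      headSum-upper : (p % 2 ≡ᵇ 0) ≡ true → let k = countBelow p (mem v) in
        ∑ N (λ a → when (allowed p a v) (head N p a v))
        ≈ (if mem v p then pick y₁ v₁ (suc k) else (pick y₂ v₂ k + fixw wₒ zₒ k))
      headSum-upper o = begin
        ∑ N f                                                  ≡⟨ ≡.cong (λ n → ∑ n f) size ⟨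
        ∑ (M ℕ.+ suc p) f                                      ≈⟨ ∑-split (suc p) M f ⟩
        (∑ p f + f p) + ∑ M (λ j → f (j ℕ.+ suc p))            ≈⟨ +-cong (trans (+-cong low here) (+-identityˡ _)) (∑-cong M high) ⟩
        when (not (mem v p)) (fixw wₒ zₒ k)
          + ∑ M (λ j → when (not (m j)) (if mem v p then (if last M m j then y₁ else v₁) else (if last M m j then y₂ else v₂)))
          ≈⟨ cases (mem v p) ≡.refl ⟩
        (if mem v p then pick y₁ v₁ (suc k) else (pick y₂ v₂ k + fixw wₒ zₒ k)) ∎
        where
        k : ℕ
        k = countBelow p (mem v)
        f : ℕ → Carrier
        f a = when (allowed p a v) (head N p a v)
        m : ℕ → Bool
        m j = mem v (j ℕ.+ suc p)
        low : ∑ p f ≈ 0#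
        low = ∑-zero p λ {a} a<p → allowed-false (≡.trans (dcond-upper o a) (≡.cong not (<ᵇ-yes a<p))) _
        here : f p ≈ when (not (mem v p)) (fixw wₒ zₒ k)
        here = trans (allowed-true (≡.trans (dcond-upper o p) (≡.cong not (<ᵇ-no (ℕₚ.n≮n p)))) _) (go (mem v p) ≡.refl)
          where
          go : ∀ b → mem v p ≡ b → when (not b) (head N p p v) ≈ when (not b) (fixw wₒ zₒ k)
          go true  _ = refl
          go false e = trans (head-fix e) (reflexive (≡.cong (λ b → if b then fixw wₒ zₒ k else fixw wₑ zₑ k) o))
        high : ∀ {j} → j < M → f (j ℕ.+ suc p) ≈
          when (not (m j)) (if mem v p then (if last M m j then y₁ else v₁) else (if last M m j then y₂ else v₂))
        high {j} j<M = trans (allowed-true (≡.trans (dcond-upper o (j ℕ.+ suc p))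
            (≡.cong not (<ᵇ-no (ℕₚ.<-asym (ℕₚ.m≤n+m (suc p) j))))) _) (go (m j) ≡.refl)
          where
          go : ∀ b → m j ≡ b → when (not b) (head N p (j ℕ.+ suc p) v) ≈
            when (not b) (if mem v p then (if last M m j then y₁ else v₁) else (if last M m j then y₂ else v₂))
          go true  _ = refl
          go false e = head-upper j<M e
        cases : ∀ b → mem v p ≡ b → when (not b) (fixw wₒ zₒ k)
          + ∑ M (λ j → when (not (m j)) (if b then (if last M m j then y₁ else v₁) else (if last M m j then y₂ else v₂)))
          ≈ (if b then pick y₁ v₁ (suc k) else (pick y₂ v₂ k + fixw wₒ zₒ k))
        cases true  e = trans (+-identityˡ _) (trans (∑-last M m y₁ v₁)
          (reflexive (≡.cong (pick y₁ v₁) (≡.trans (countBelow-missing s) (≡.cong (λ b → bit b ℕ.+ k) e)))))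
        cases false e = trans (+-comm _ _) (+-congʳ (trans (∑-last M m y₂ v₂)
          (reflexive (≡.cong (pick y₂ v₂) (≡.trans (countBelow-missing s) (≡.cong (λ b → bit b ℕ.+ k) e))))))

      -- A letter at or above p does not affect which values below p occur, so the match condition
      -- leaves the sum. The bit at p, not prescribed so far, becomes part of the next state.
      sum-upper : (p % 2 ≡ᵇ 0) ≡ true → ∀ H → let k = countBelow p H in
        ∑ N (λ a → when (match p H (a ∷ v)) (W N (a ∷ v)))
        ≈ when (match (suc p) (set p true H) v) (W N v) * pick y₁ v₁ (suc k)
          + when (match (suc p) (set p false H) v) (W N v) * (pick y₂ v₂ k + fixw wₒ zₒ k)
      sum-upper o H = begin
        ∑ N (λ a → when (match p H (a ∷ v)) (W N (a ∷ v)))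
          ≈⟨ ∑-cong N (λ {a} _ → term a) ⟩
        ∑ N (λ a → when (match p H v) (when (allowed p a v) (head N p a v) * W N v))
          ≈⟨ ∑-when N (match p H v) _ ⟩
        when (match p H v) (∑ N (λ a → when (allowed p a v) (head N p a v) * W N v))
          ≈⟨ when-cong (match p H v) (trans (∑-*ʳ N _ (W N v)) (*-congʳ (headSum-upper o))) ⟩
        when (match p H v) (coeff (countBelow p (mem v)) (mem v p) * W N v)
          ≈⟨ cases (match p H v) (mem v p) (match-count p v ∘ true⇒T) ⟩
        when (eqB (mem v p) true ∧ match p H v) (W N v) * pick y₁ v₁ (suc k)
          + when (eqB (mem v p) false ∧ match p H v) (W N v) * (pick y₂ v₂ k + fixw wₒ zₒ k)
          ≡⟨ ≡.cong₂ (λ b b′ → when b (W N v) * pick y₁ v₁ (suc k) + when b′ (W N v) * (pick y₂ v₂ k + fixw wₒ zₒ k))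
               (match-set p true H v) (match-set p false H v) ⟨
        when (match (suc p) (set p true H) v) (W N v) * pick y₁ v₁ (suc k)
          + when (match (suc p) (set p false H) v) (W N v) * (pick y₂ v₂ k + fixw wₒ zₒ k) ∎
        where
        k : ℕ
        k = countBelow p H
        coeff : ℕ → Bool → Carrier
        coeff k b = if b then pick y₁ v₁ (suc k) else (pick y₂ v₂ k + fixw wₒ zₒ k)
        term : ∀ a → when (match p H (a ∷ v)) (W N (a ∷ v))
                   ≈ when (match p H v) (when (allowed p a v) (head N p a v) * W N v)
        term a with a ℕ.<? p
        ... | yes a<p = trans (when-zero (match p H (a ∷ v)) (trans (W-step a) zero′)) (sym (when-zero (match p H v) zero′))
          where
          zero′ : when (allowed p a v) (head N p a v) * W N v ≈ 0#
          zero′ = trans (*-congʳ (allowed-false (≡.trans (dcond-upper o a) (≡.cong not (<ᵇ-yes a<p))) _)) (zeroˡ _)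
        ... | no a≮p rewrite match-upper p H v (ℕₚ.≮⇒≥ a≮p) = when-cong (match p H v) (W-step a)
        cases : ∀ b b′ → (b ≡ true → countBelow p (mem v) ≡ k) → when b (coeff (countBelow p (mem v)) b′ * W N v)
          ≈ when (eqB b′ true ∧ b) (W N v) * pick y₁ v₁ (suc k)
            + when (eqB b′ false ∧ b) (W N v) * (pick y₂ v₂ k + fixw wₒ zₒ k)
        cases false b′ _ rewrite ∧-zeroʳ (eqB b′ true) | ∧-zeroʳ (eqB b′ false) =
          sym (trans (+-cong (zeroˡ _) (zeroˡ _)) (+-identityˡ 0#))
        cases true true  e rewrite e ≡.refl = trans (*-comm _ _) (sym (trans (+-congˡ (zeroˡ _)) (+-identityʳ _)))
        cases true false e rewrite e ≡.refl = trans (*-comm _ _) (sym (trans (+-congʳ (zeroˡ _)) (+-identityˡ _)))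

      -- Here the letter a comes out of `H`, so each a leads to a different state. The sum over a
      -- has to stay until the state sums are known to depend on sizes only.
      sum-lower : (p % 2 ≡ᵇ 0) ≡ false → ∀ H → let k = countBelow p H in
        ∑ N (λ a → when (match p H (a ∷ v)) (W N (a ∷ v)))
        ≈ ∑ p (λ a → when (H a)
              (when (match (suc p) (set p false (set a false H)) v) (W N v) * (if first a H then x₁ else u₁)
             + when (match (suc p) (set p true (set a false H)) v) (W N v) * (if first a H then x₂ else u₂)))
          + when (match (suc p) (set p false H) v) (W N v) * fixw wₑ zₑ k
      sum-lower o H = begin
        ∑ N f                                        ≡⟨ ≡.cong (λ n → ∑ n f) size ⟨
        ∑ (M ℕ.+ suc p) f                            ≈⟨ ∑-split (suc p) M f ⟩
        (∑ p f + f p) + ∑ M (λ j → f (j ℕ.+ suc p))  ≈⟨ trans (+-congˡ high) (+-identityʳ _) ⟩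
        ∑ p f + f p                                  ≈⟨ +-cong (∑-cong p low) here ⟩
        ∑ p _ + when (match (suc p) (set p false H) v) (W N v) * fixw wₑ zₑ k ∎
        where
        k : ℕ
        k = countBelow p H
        f : ℕ → Carrier
        f a = when (match p H (a ∷ v)) (W N (a ∷ v))
        high : ∑ M (λ j → f (j ℕ.+ suc p)) ≈ 0#
        high = ∑-zero M λ {j} _ → when-zero (match p H (j ℕ.+ suc p ∷ v)) (trans (W-step _) (trans (*-congʳ
          (allowed-false (≡.trans (dcond-lower o _) (≡.cong not (<ᵇ-yes (ℕₚ.m≤n+m (suc p) j)))) _)) (zeroˡ _)))
        here : f p ≈ when (match (suc p) (set p false H) v) (W N v) * fixw wₑ zₑ k
        here rewrite match-upper p H v (ℕₚ.≤-refl {p}) | match-set p false H v =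
          trans (when-cong (match p H v) (trans (W-step p) (*-congʳ (allowed-true
            (≡.trans (dcond-lower o p) (≡.cong not (<ᵇ-no (ℕₚ.n≮n p)))) _))))
            (go (match p H v) (mem v p) (match-count p v ∘ true⇒T) ≡.refl)
          where
          go : ∀ b b′ → (b ≡ true → countBelow p (mem v) ≡ k) → mem v p ≡ b′ →
            when b (when (not b′) (head N p p v) * W N v) ≈ when (eqB b′ false ∧ b) (W N v) * fixw wₑ zₑ k
          go false b′    _ _ rewrite ∧-zeroʳ (eqB b′ false) = sym (zeroˡ _)
          go true  true  _ _ = trans (zeroˡ _) (sym (zeroˡ _))
          go true  false e m = trans (*-congʳ (trans (head-fix m) (reflexive (≡.cong₂
            (λ b k → if b then fixw wₒ zₒ k else fixw wₑ zₑ k) o (e ≡.refl))))) (*-comm _ _)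
        low : ∀ {a} → a < p → f a ≈ when (H a)
          (when (match (suc p) (set p false (set a false H)) v) (W N v) * (if first a H then x₁ else u₁)
          + when (match (suc p) (set p true (set a false H)) v) (W N v) * (if first a H then x₂ else u₂))
        low {a} a<p rewrite match-set p false (set a false H) v | match-set p true (set a false H) v = begin
          when (match p H (a ∷ v)) (W N (a ∷ v))
            ≈⟨ when-cong (match p H (a ∷ v)) (trans (W-step a) (*-congʳ (allowed-true
                 (≡.trans (dcond-lower o a) (≡.cong not (<ᵇ-no (ℕₚ.<-asym a<p)))) _))) ⟩
          when (match p H (a ∷ v)) (when (not (mem v a)) (head N p a v) * W N v)
            ≈⟨ when-cong (match p H (a ∷ v)) (when-*ʳ (not (mem v a)) _ _) ⟨
          when (match p H (a ∷ v)) (when (not (mem v a)) (head N p a v * W N v))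
            ≈⟨ when-∧ (match p H (a ∷ v)) _ _ ⟨
          when (match p H (a ∷ v) ∧ not (mem v a)) (head N p a v * W N v)
            ≡⟨ ≡.cong (λ b → when b (head N p a v * W N v)) (≡.trans (∧-comm _ (not (mem v a))) (match-lower p H v a<p)) ⟩
          when (H a ∧ match p (set a false H) v) (head N p a v * W N v)
            ≈⟨ when-∧ (H a) _ _ ⟩
          when (H a) (when (match p (set a false H) v) (head N p a v * W N v))
            ≈⟨ when-cong (H a) (go (match p (set a false H) v) (mem v p) (anti-lower p H v a<p ∘ true⇒T) (head-lower a<p)) ⟩
          when (H a) _ ∎
          where
          go : ∀ b b′ → (b ≡ true → anti a v ≡ first a H) →
            head N p a v ≈ (if b′ then (if anti a v then x₂ else u₂) else (if anti a v then x₁ else u₁)) →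
            when b (head N p a v * W N v) ≈
            when (eqB b′ false ∧ b) (W N v) * (if first a H then x₁ else u₁)
            + when (eqB b′ true ∧ b) (W N v) * (if first a H then x₂ else u₂)
          go false b′ _ _ rewrite ∧-zeroʳ (eqB b′ true) | ∧-zeroʳ (eqB b′ false) =
            sym (trans (+-cong (zeroˡ _) (zeroˡ _)) (+-identityˡ 0#))
          go true true  e h rewrite e ≡.refl = trans (*-congʳ h) (trans (*-comm _ _) (sym (trans (+-congʳ (zeroˡ _)) (+-identityˡ _))))
          go true false e h rewrite e ≡.refl = trans (*-congʳ h) (trans (*-comm _ _) (sym (trans (+-congˡ (zeroˡ _)) (+-identityʳ _))))

    -- H selects the values below p that the positions below p leave free.
    stateSum : ℕ → ℕ → ℕ → (ℕ → Bool) → Carrier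
    stateSum N M p H = sumWords N M (λ v → when (match p H v) (W N v))

    private
      case-distinct : ∀ {N v} {X : Set ℓ} → (T (distinct v) → X) → (W N v ≈ 0# → (∀ a → W N (a ∷ v) ≈ 0#) → X) → X
      case-distinct {N} {v} f g with T? (distinct v)
      ... | yes d = f d
      ... | no ¬d = g (W-repeat N v (¬T⇒false ¬d)) λ a → W-repeat N (a ∷ v)
        (≡.trans (≡.cong (not (mem v a) ∧_) (¬T⇒false ¬d)) (∧-zeroʳ _))

      vanish : ∀ b {w} x → w ≈ 0# → when b w * x ≈ 0#
      vanish b x w≈0 = trans (*-congʳ (when-zero b w≈0)) (zeroˡ x)

    stateSum-upper : ∀ {N M p} → M ℕ.+ suc p ≡ N → (p % 2 ≡ᵇ 0) ≡ true → ∀ H → let k = countBelow p H in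
      stateSum N (suc M) p H ≈ stateSum N M (suc p) (set p true H) * pick y₁ v₁ (suc k)
                             + stateSum N M (suc p) (set p false H) * (pick y₂ v₂ k + fixw wₒ zₒ k)
    stateSum-upper {N} {M} {p} size o H = trans
      (sumWords-cong N M λ {v} len bdd → case-distinct {N} {v}
        (λ d → sum-upper (record { size = size ; len = len ; unique = d ; bounded = bdd }) o H)
        (λ z zs → trans (∑-zero N λ {a} _ → when-zero (match p H (a ∷ v)) (zs a))
          (sym (trans (+-cong (vanish (match (suc p) (set p true H) v) _ z)
                              (vanish (match (suc p) (set p false H) v) _ z)) (+-identityˡ 0#)))))
      (trans (sumWords-+ N M _ _) (+-cong (sumWords-*ʳ N M _ _) (sumWords-*ʳ N M _ _)))

    stateSum-lower : ∀ {N M p} → M ℕ.+ suc p ≡ N → (p % 2 ≡ᵇ 0) ≡ false → ∀ H → let k = countBelow p H in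
      stateSum N (suc M) p H ≈
        ∑ p (λ a → when (H a)
              (stateSum N M (suc p) (set p false (set a false H)) * (if first a H then x₁ else u₁)
             + stateSum N M (suc p) (set p true (set a false H)) * (if first a H then x₂ else u₂)))
        + stateSum N M (suc p) (set p false H) * fixw wₑ zₑ k
    stateSum-lower {N} {M} {p} size o H = trans
      (sumWords-cong N M λ {v} len bdd → case-distinct {N} {v}
        (λ d → sum-lower (record { size = size ; len = len ; unique = d ; bounded = bdd }) o H)
        (λ z zs → trans (∑-zero N λ {a} _ → when-zero (match p H (a ∷ v)) (zs a))
          (sym (trans (+-cong (∑-zero p λ {a} _ → when-zero (H a)
                (trans (+-cong (vanish (match (suc p) (set p false (set a false H)) v) _ z)
                               (vanish (match (suc p) (set p true (set a false H)) v) _ z)) (+-identityˡ 0#)))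
              (vanish (match (suc p) (set p false H) v) _ z)) (+-identityˡ 0#)))))
      (trans (sumWords-+ N M _ _) (+-cong
        (trans (sumWords-∑ N M p _) (∑-cong p λ {a} _ → trans (sumWords-when N M (H a) _)
          (when-cong (H a) (trans (sumWords-+ N M _ _) (+-cong (sumWords-*ʳ N M _ _) (sumWords-*ʳ N M _ _))))))
        (sumWords-*ʳ N M _ _)))

    -- Induction on the number of remaining pairs, mutual with `stateSum-odd`. In the odd case the
    -- hypothesis makes the states `set a false H` all worth the same, so they factor out and
    -- `∑-first` applies.
    stateSum-even : ∀ {N} n p → double n ℕ.+ p ≡ N → (p % 2 ≡ᵇ 0) ≡ true → ∀ H →
      stateSum N (double n) p H ≈ evenSum n (countBelow p H)
    stateSum-odd : ∀ {N} n p → suc (double n) ℕ.+ p ≡ N → (p % 2 ≡ᵇ 0) ≡ false → ∀ H →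
      stateSum N (suc (double n)) p H ≈ oddSum n (countBelow p H)

    -- On the empty word `match p H` computes to `first p H`: no value below p may be prescribed.
    stateSum-even zero p size o H with match p H [] | first-none p H
    ... | b | eq rewrite eq with countBelow p H
    ...   | zero  = refl
    ...   | suc _ = refl
    stateSum-even (suc n) p size o H = trans (stateSum-upper {M = suc (double n)} {p} size′ o H) (+-cong
      (*-congʳ (trans (stateSum-odd n (suc p) size′ o′ (set p true H)) (reflexive (≡.cong (oddSum n) (countBelow-set-top p true H)))))
      (*-congʳ (trans (stateSum-odd n (suc p) size′ o′ (set p false H)) (reflexive (≡.cong (oddSum n) (countBelow-set-top p false H))))))
      where
      size′ = ≡.trans (ℕₚ.+-suc (suc (double n)) p) size
      o′ = ≡.trans (parity-suc p) (≡.cong not o)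

    stateSum-odd {N} n p size o H = begin
      stateSum N (suc (double n)) p H
        ≈⟨ stateSum-lower {M = double n} {p} size′ o H ⟩
      ∑ p (λ a → when (H a)
            (stateSum N (double n) (suc p) (set p false (set a false H)) * (if first a H then x₁ else u₁)
           + stateSum N (double n) (suc p) (set p true (set a false H)) * (if first a H then x₂ else u₂)))
        + stateSum N (double n) (suc p) (set p false H) * fixw wₑ zₑ k
        ≈⟨ +-cong (trans (∑-cong p summand) (trans (∑-+ p _ _) (+-cong
                    (trans (∑-*ʳ p _ _) (*-congʳ (∑-first p H x₁ u₁)))
                    (trans (∑-*ʳ p _ _) (*-congʳ (∑-first p H x₂ u₂))))))
                  (*-congʳ (trans (IH (set p false H)) (reflexive (≡.cong (evenSum n) (countBelow-set-top p false H))))) ⟩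
      (pick x₁ u₁ k * evenSum n (k ∸ 1) + pick x₂ u₂ k * evenSum n k) + evenSum n k * fixw wₑ zₑ k
        ≈⟨ solve 5 (λ a e b e′ w → (a :* e :+ b :* e′) :+ e′ :* w := e :* a :+ e′ :* (b :+ w)) refl _ _ _ _ _ ⟩
      oddSum n k ∎
      where
      k = countBelow p H
      size′ = ≡.trans (ℕₚ.+-suc (double n) p) size
      IH = stateSum-even n (suc p) size′ (≡.trans (parity-suc p) (≡.cong not o))
      count-drop : ∀ {a} b → a < p → H a ≡ true → countBelow (suc p) (set p b (set a false H)) ≡ bit b ℕ.+ (k ∸ 1)
      count-drop {a} b a<p Ha = ≡.trans (countBelow-set-top p b (set a false H)) (≡.cong (λ m → bit b ℕ.+ (m ∸ 1))
        (≡.trans (≡.cong (λ c → bit c ℕ.+ countBelow p (set a false H)) (≡.sym Ha)) (countBelow-set p false H a<p)))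
      k≢0 : ∀ {a} → a < p → H a ≡ true → suc (k ∸ 1) ≡ k
      k≢0 {a} a<p Ha = ≡.subst (λ k → suc (k ∸ 1) ≡ k)
        (≡.trans (≡.cong (λ c → bit c ℕ.+ countBelow p (set a false H)) (≡.sym Ha)) (countBelow-set p false H a<p)) ≡.refl
      summand : ∀ {a} → a < p → when (H a)
            (stateSum N (double n) (suc p) (set p false (set a false H)) * (if first a H then x₁ else u₁)
           + stateSum N (double n) (suc p) (set p true (set a false H)) * (if first a H then x₂ else u₂))
        ≈ when (H a) (if first a H then x₁ else u₁) * evenSum n (k ∸ 1) + when (H a) (if first a H then x₂ else u₂) * evenSum n k
      summand {a} a<p = go (H a) ≡.refl
        where
        go : ∀ b → H a ≡ b → when b
            (stateSum N (double n) (suc p) (set p false (set a false H)) * (if first a H then x₁ else u₁)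
           + stateSum N (double n) (suc p) (set p true (set a false H)) * (if first a H then x₂ else u₂))
          ≈ when b (if first a H then x₁ else u₁) * evenSum n (k ∸ 1) + when b (if first a H then x₂ else u₂) * evenSum n k
        go false _ = sym (trans (+-cong (zeroˡ _) (zeroˡ _)) (+-identityˡ 0#))
        go true Ha = +-cong
          (trans (*-congʳ (trans (IH _) (reflexive (≡.cong (evenSum n) (count-drop false a<p Ha))))) (*-comm _ _))
          (trans (*-congʳ (trans (IH _) (reflexive (≡.cong (evenSum n) (≡.trans (count-drop true a<p Ha) (k≢0 a<p Ha)))))) (*-comm _ _))

-- Power series and the T-fraction

module TFraction {c ℓ : Level} (R : CommutativeRing c ℓ) where

  open CommutativeRing R hiding (zero)
  open Ring R
  open Words using (double)
  open WordSums R
  open import Relation.Binary.Reasoning.Setoid setoid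
  open import Algebra.Solver.Ring.NaturalCoefficients.Default commutativeSemiring
    using (solve; _:=_; _:+_; _:*_; con)

  ∑-head : ∀ n f → ∑ (suc n) f ≈ f 0 + ∑ n (f ∘ suc)
  ∑-head zero    f = +-comm 0# (f 0)
  ∑-head (suc n) f = trans (+-congʳ (∑-head n f)) (+-assoc _ _ _)

  sumL-applyUpTo : ∀ n f → sumL (applyUpTo f n) ≈ ∑ n f
  sumL-applyUpTo zero    f = refl
  sumL-applyUpTo (suc n) f = trans (+-congˡ (sumL-applyUpTo n (f ∘ suc))) (sym (∑-head n f))

  sumL-upTo : ∀ n f → sumL (map f (upTo n)) ≈ ∑ n f
  sumL-upTo n f = trans (reflexive (≡.cong sumL (map-applyUpTo (λ i → i) f n))) (sumL-applyUpTo n f)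

  -- The Cauchy product by recursion on the left factor, so that its laws follow by induction on the
  -- coefficient.
  conv : Series → Series → Series
  conv f g zero    = f 0 * g 0
  conv f g (suc n) = f 0 * g (suc n) + conv (f ∘ suc) g n

  ∑-conv : ∀ n f g → ∑ (suc n) (λ i → f i * g (n ∸ i)) ≈ conv f g n
  ∑-conv zero    f g = +-identityˡ _
  ∑-conv (suc n) f g = trans (∑-head (suc n) _) (+-congˡ (∑-conv n (f ∘ suc) g))

  *S-conv : ∀ f g n → (f *S g) n ≈ conv f g n
  *S-conv f g n = trans (sumL-upTo (suc n) _) (∑-conv n f g)

  conv-cong : ∀ n {f f′ g g′} → (∀ {i} → i ≤ n → f i ≈ f′ i) → (∀ {i} → i ≤ n → g i ≈ g′ i) → conv f g n ≈ conv f′ g′ n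
  conv-cong zero    hf hg = *-cong (hf z≤n) (hg z≤n)
  conv-cong (suc n) hf hg = +-cong (*-cong (hf z≤n) (hg ℕₚ.≤-refl)) (conv-cong n (hf ∘ s≤s) (hg ∘ ℕₚ.m≤n⇒m≤1+n))

  conv-zeroˡ : ∀ n g → conv zeroS g n ≈ 0#
  conv-zeroˡ zero    g = zeroˡ _
  conv-zeroˡ (suc n) g = trans (+-cong (zeroˡ _) (conv-zeroˡ n g)) (+-identityˡ 0#)

  conv-zeroʳ : ∀ n f → conv f zeroS n ≈ 0#
  conv-zeroʳ zero    f = zeroʳ _
  conv-zeroʳ (suc n) f = trans (+-cong (zeroʳ _) (conv-zeroʳ n _)) (+-identityˡ 0#)

  conv-oneˡ : ∀ n g → conv oneS g n ≈ g n
  conv-oneˡ zero    g = *-identityˡ _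
  conv-oneˡ (suc n) g = trans (+-cong (*-identityˡ _) (conv-zeroˡ n g)) (+-identityʳ _)

  conv-+ˡ : ∀ n f f′ g → conv (f +S f′) g n ≈ conv f g n + conv f′ g n
  conv-+ˡ zero    f f′ g = distribʳ _ _ _
  conv-+ˡ (suc n) f f′ g = trans (+-cong (distribʳ _ _ _) (conv-+ˡ n _ _ g))
    (solve 4 (λ a b c d → (a :+ b) :+ (c :+ d) := (a :+ c) :+ (b :+ d)) refl _ _ _ _)

  conv-+ʳ : ∀ n f g g′ → conv f (g +S g′) n ≈ conv f g n + conv f g′ n
  conv-+ʳ zero    f g g′ = distribˡ _ _ _
  conv-+ʳ (suc n) f g g′ = trans (+-cong (distribˡ _ _ _) (conv-+ʳ n _ g g′))
    (solve 4 (λ a b c d → (a :+ b) :+ (c :+ d) := (a :+ c) :+ (b :+ d)) refl _ _ _ _)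

  conv-scaleˡ : ∀ n a f g → conv (scale a f) g n ≈ a * conv f g n
  conv-scaleˡ zero    a f g = *-assoc _ _ _
  conv-scaleˡ (suc n) a f g = trans (+-cong (*-assoc _ _ _) (conv-scaleˡ n a _ g)) (sym (distribˡ _ _ _))

  conv-scaleʳ : ∀ n a f g → conv f (scale a g) n ≈ a * conv f g n
  conv-scaleʳ zero    a f g = solve 3 (λ a f g → f :* (a :* g) := a :* (f :* g)) refl a _ _
  conv-scaleʳ (suc n) a f g = trans (+-congˡ (conv-scaleʳ n a _ g))
    (solve 4 (λ a f g c → f :* (a :* g) :+ a :* c := a :* (f :* g :+ c)) refl a _ _ _)

  conv-shiftʳ : ∀ n f g → conv f (shiftS g) (suc n) ≈ conv f g n
  conv-shiftʳ zero    f g = trans (+-congˡ (zeroʳ _)) (+-identityʳ _)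
  conv-shiftʳ (suc n) f g = +-congˡ (conv-shiftʳ n (f ∘ suc) g)

  conv-assoc : ∀ n f g h → conv (conv f g) h n ≈ conv f (conv g h) n
  conv-assoc zero    f g h = *-assoc _ _ _
  conv-assoc (suc n) f g h = begin
    f 0 * g 0 * h (suc n) + conv (scale (f 0) (g ∘ suc) +S conv (f ∘ suc) g) h n
      ≈⟨ +-congˡ (trans (conv-+ˡ n _ _ h) (+-cong (conv-scaleˡ n (f 0) _ h) (conv-assoc n _ g h))) ⟩
    f 0 * g 0 * h (suc n) + (f 0 * conv (g ∘ suc) h n + conv (f ∘ suc) (conv g h) n)
      ≈⟨ solve 5 (λ f g h a b → f :* g :* h :+ (f :* a :+ b) := f :* (g :* h :+ a) :+ b) refl _ _ _ _ _ ⟩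
    f 0 * (g 0 * h (suc n) + conv (g ∘ suc) h n) + conv (f ∘ suc) (conv g h) n ∎

  ∑-conv-swap : ∀ n K h (p : ℕ → Series) → ∑ K (λ k → conv h (p k) n) ≈ conv h (λ m → ∑ K (λ k → p k m)) n
  ∑-conv-swap n zero    h p = sym (conv-zeroʳ n h)
  ∑-conv-swap n (suc K) h p = trans (+-congʳ (∑-conv-swap n K h p)) (sym (conv-+ʳ n h _ (p K)))

  ∑-truncate : ∀ {m n} f → m ≤ n → (∀ {i} → m ≤ i → f i ≈ 0#) → ∑ n f ≈ ∑ m f
  ∑-truncate {m} {n} f m≤n h = begin
    ∑ n f                               ≡⟨ ≡.cong (λ n → ∑ n f) (ℕₚ.m∸n+n≡m m≤n) ⟨
    ∑ (n ∸ m ℕ.+ m) f                   ≈⟨ ∑-split m (n ∸ m) f ⟩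
    ∑ m f + ∑ (n ∸ m) (λ j → f (j ℕ.+ m)) ≈⟨ +-congˡ (∑-zero (n ∸ m) λ {j} _ → h (ℕₚ.m≤n+m m j)) ⟩
    ∑ m f + 0#                          ≈⟨ +-identityʳ _ ⟩
    ∑ m f ∎

  powS-suc : ∀ h k n → powS (shiftS h) (suc k) (suc n) ≈ conv h (powS (shiftS h) k) n
  powS-suc h k n = trans (*S-conv (shiftS h) _ (suc n)) (trans (+-congʳ (zeroˡ _)) (+-identityˡ _))

  -- Every factor contributes at least one t. Hence cutting the geometric series at the exponent of
  -- the coefficient loses nothing.
  powS-order : ∀ h k n → n < k → powS (shiftS h) k n ≈ 0#
  powS-order h (suc k) zero    _   = trans (*S-conv (shiftS h) (powS (shiftS h) k) 0) (zeroˡ _)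
  powS-order h (suc k) (suc n) n<k = trans (powS-suc h k n) (trans
    (conv-cong n {f′ = h} {g′ = zeroS} (λ _ → refl) (λ {i} i≤n → powS-order h k i (ℕₚ.≤-<-trans i≤n (ℕₚ.≤-pred n<k))))
    (conv-zeroʳ n h))

  geomS-zero : ∀ g → geomS g 0 ≈ 1#
  geomS-zero g = +-identityʳ _

  -- The equation g = 1 + t h g for g = 1/(1 - t h), at a positive exponent. The two sides cut the
  -- sum over powers at different places, which `powS-order` reconciles.
  geomS-suc : ∀ h n → geomS (shiftS h) (suc n) ≈ conv h (geomS (shiftS h)) n
  geomS-suc h n = begin
    geomS g (suc n)                                     ≈⟨ sumL-upTo (suc (suc n)) _ ⟩
    ∑ (suc (suc n)) (λ k → powS g k (suc n))            ≈⟨ ∑-head (suc n) _ ⟩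
    0# + ∑ (suc n) (λ k → powS g (suc k) (suc n))       ≈⟨ +-identityˡ _ ⟩
    ∑ (suc n) (λ k → powS g (suc k) (suc n))            ≈⟨ ∑-cong (suc n) (λ {k} _ → powS-suc h k n) ⟩
    ∑ (suc n) (λ k → conv h (powS g k) n)               ≈⟨ ∑-conv-swap n (suc n) h (powS g) ⟩
    conv h (λ m → ∑ (suc n) (λ k → powS g k m)) n       ≈⟨ conv-cong n (λ _ → refl) (λ {m} m≤n →
      trans (∑-truncate _ (s≤s m≤n) (λ {k} → powS-order h k m)) (sym (sumL-upTo (suc m) _))) ⟩
    conv h (geomS g) n ∎
    where g = shiftS h

  -- Limit of the convergents, and paths weighted by the fraction

  module Fraction (α δ : ℕ → Carrier) where

    private
      C : ℕ → ℕ → Series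
      C = convergent α δ

    convergent-suc : ∀ d k n → C (suc d) k (suc n) ≈ δ k * C (suc d) k n + α k * conv (C d (suc k)) (C (suc d) k) n
    convergent-suc d k n = trans (geomS-suc _ n) (trans (conv-+ˡ n _ _ _)
      (+-cong (trans (conv-scaleˡ n (δ k) oneS _) (*-congˡ (conv-oneˡ n _))) (conv-scaleˡ n (α k) _ _)))

    -- Each descent to the next level of the fraction costs a factor t, so coefficients of exponent
    -- below d do not see levels beyond depth d. All i up to n are treated at once because a
    -- convolution needs every smaller coefficient.
    convergent-stable : ∀ d n → n < d → ∀ k {i} → i ≤ n → C d k i ≈ C (suc d) k i
    convergent-stable (suc d) _       _   k {zero}  _   = refl
    convergent-stable (suc d) (suc n) n<d k {suc i} i≤n = begin
      C (suc d) k (suc i) ≈⟨ convergent-suc d k i ⟩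
      δ k * C (suc d) k i + α k * conv (C d (suc k)) (C (suc d) k) i
        ≈⟨ +-cong (*-congˡ (tail ℕₚ.≤-refl)) (*-congˡ (conv-cong i
             (λ j≤i → convergent-stable d n (ℕₚ.≤-pred n<d) (suc k) (ℕₚ.≤-trans j≤i (ℕₚ.≤-pred i≤n)))
             tail)) ⟩
      δ k * C (suc (suc d)) k i + α k * conv (C (suc d) (suc k)) (C (suc (suc d)) k) i ≈⟨ convergent-suc (suc d) k i ⟨
      C (suc (suc d)) k (suc i) ∎
      where
      tail : ∀ {j} → j ≤ i → C (suc d) k j ≈ C (suc (suc d)) k j
      tail j≤i = convergent-stable (suc d) n (ℕₚ.m≤n⇒m≤1+n (ℕₚ.≤-pred n<d)) k (ℕₚ.≤-trans j≤i (ℕₚ.≤-pred i≤n))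

    -- The infinite fraction starting at level k: each coefficient is taken from a depth at which it
    -- is already stable.
    F : ℕ → Series
    F k n = C (suc n) k n

    convergent-limit : ∀ {d n} → n < d → ∀ k → C d k n ≈ F k n
    convergent-limit {d} {n} n<d k = go (ℕₚ.m≤n⇒∃[o]m+o≡n n<d)
      where
      up : ∀ j → C (j ℕ.+ suc n) k n ≈ F k n
      up zero    = refl
      up (suc j) = trans (sym (convergent-stable (j ℕ.+ suc n) n (ℕₚ.m≤n+m (suc n) j) k ℕₚ.≤-refl)) (up j)
      go : ∃ (λ j → suc n ℕ.+ j ≡ d) → C d k n ≈ F k n
      go (j , eq) = ≡.subst (λ d → C d k n ≈ F k n) (≡.trans (ℕₚ.+-comm j (suc n)) eq) (up j)

    F-zero : ∀ k → F k 0 ≈ 1#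
    F-zero k = geomS-zero (shiftS (scale (δ k) oneS +S scale (α k) zeroS))

    F-suc : ∀ k n → F k (suc n) ≈ δ k * F k n + α k * conv (F (suc k)) (F k) n
    F-suc k n = trans (convergent-suc (suc n) k n) (+-cong
      (*-congˡ (convergent-limit {suc (suc n)} (s≤s (ℕₚ.n≤1+n n)) k))
      (*-congˡ (conv-cong n (λ i≤n → convergent-limit (s≤s i≤n) (suc k))
        (λ i≤n → convergent-limit (ℕₚ.m≤n⇒m≤1+n (s≤s i≤n)) k))))

    -- t^h α₁⋯α_h F₁⋯F_{h+1}: the generating function of paths from height h down to 0.
    E : ℕ → Series
    E zero    = F 1
    E (suc h) = scale (α (suc h)) (shiftS (conv (F (suc (suc h))) (E h)))

    E-order : ∀ h n → n < h → E h n ≈ 0#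
    E-order (suc h) zero    _   = zeroʳ _
    E-order (suc h) (suc n) n<h = trans (*-congˡ (trans
      (conv-cong n {f′ = F (suc (suc h))} {g′ = zeroS} (λ _ → refl) (λ {i} i≤n → E-order h i (ℕₚ.≤-<-trans i≤n (ℕₚ.≤-pred n<h))))
      (conv-zeroʳ n (F (suc (suc h)))))) (zeroʳ _)

    E-ground : ∀ n → E 0 (suc n) ≈ δ 1 * E 0 n + E 1 (suc n)
    E-ground n = F-suc 1 n

    module _ (δ-zero : ∀ k → δ (suc (suc k)) ≈ 0#) where

      -- With δ zero at level h + 2, F = 1 + α t F' F, where F' is the next level. The term 1 is a
      -- first step down, charged α and t; the other term is a first step up, charged nothing.
      E-step : ∀ h n → E (suc h) (suc n) ≈ α (suc h) * E h n + E (suc (suc h)) (suc n)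
      E-step h zero = begin
        α (suc h) * (F (suc (suc h)) 0 * E h 0)   ≈⟨ *-congˡ (trans (*-congʳ (F-zero (suc (suc h)))) (*-identityˡ _)) ⟩
        α (suc h) * E h 0                         ≈⟨ +-identityʳ _ ⟨
        α (suc h) * E h 0 + 0#                    ≈⟨ +-congˡ (trans (*-congˡ (trans (*-congˡ (zeroʳ _)) (zeroʳ _))) (zeroʳ _)) ⟨
        α (suc h) * E h 0 + E (suc (suc h)) 1 ∎
      E-step h (suc n) = begin
        a * (F h₂ 0 * E h (suc n) + conv (F h₂ ∘ suc) (E h) n)
          ≈⟨ *-congˡ (+-cong (trans (*-congʳ (F-zero h₂)) (*-identityˡ _)) (trans
               (conv-cong n {g′ = E h} (λ {i} _ → trans (F-suc h₂ i)
                 (trans (+-congʳ (trans (*-congʳ (δ-zero h)) (zeroˡ _))) (+-identityˡ _))) (λ _ → refl))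
               (trans (conv-scaleˡ n b _ _) (*-congˡ (conv-assoc n _ _ _))))) ⟩
        a * (E h (suc n) + b * conv (F h₃) (conv (F h₂) (E h)) n)
          ≈⟨ solve 4 (λ a e b c → a :* (e :+ b :* c) := a :* e :+ b :* (a :* c)) refl a _ b _ ⟩
        a * E h (suc n) + b * (a * conv (F h₃) (conv (F h₂) (E h)) n)
          ≈⟨ +-congˡ (*-congˡ (trans (conv-scaleʳ (suc n) a (F h₃) _) (*-congˡ (conv-shiftʳ n (F h₃) _)))) ⟨
        a * E h (suc n) + E h₂ (suc (suc n)) ∎
        where
        h₂ = suc (suc h)
        h₃ = suc h₂
        a = α (suc h)
        b = α h₂

      -- Only even heights, normalised so that every double step costs one t.
      G : ℕ → Series
      G k n = E (double k) (n ℕ.+ k)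

      G-ground : ∀ n → G 0 (suc n) ≈ (δ 1 + α 1) * G 0 n + G 1 n
      G-ground n = begin
        E 0 (suc (n ℕ.+ 0))                             ≈⟨ E-ground (n ℕ.+ 0) ⟩
        δ 1 * G 0 n + E 1 (suc (n ℕ.+ 0))               ≈⟨ +-congˡ (E-step 0 (n ℕ.+ 0)) ⟩
        δ 1 * G 0 n + (α 1 * G 0 n + E 2 (suc (n ℕ.+ 0)))
          ≈⟨ +-congˡ (+-congˡ (reflexive (≡.cong (E 2) (≡.trans (≡.cong suc (ℕₚ.+-identityʳ n)) (≡.sym (ℕₚ.+-comm n 1)))))) ⟩
        δ 1 * G 0 n + (α 1 * G 0 n + G 1 n)
          ≈⟨ solve 4 (λ d a g h → d :* g :+ (a :* g :+ h) := (d :+ a) :* g :+ h) refl _ _ _ _ ⟩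
        (δ 1 + α 1) * G 0 n + G 1 n ∎

      -- Two applications of `E-step`: down-down, down-up, up-down and up-up. This is the even
      -- contraction of the fraction.
      G-step : ∀ j n → let k = suc j; h = double j in
        G k (suc n) ≈ α (suc (suc h)) * (α (suc h) * G j n + G k n) + (α (suc (suc (suc h))) * G k n + G (suc k) n)
      G-step j n rewrite ℕₚ.+-suc n j | ℕₚ.+-suc n (suc j) | ℕₚ.+-suc n j = trans (E-step (suc h) (suc (n ℕ.+ j)))
        (+-cong (*-congˡ (E-step h (n ℕ.+ j))) (E-step (suc (suc h)) (suc (n ℕ.+ j))))
        where h = double j

  double-*2 : ∀ k → double k ≡ k ℕ.* 2
  double-*2 zero    = ≡.refl
  double-*2 (suc k) = ≡.cong (λ m → ℕ.suc (ℕ.suc m)) (double-*2 k)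

  -- The contracted fraction and the transfer recursion agree

  module _ (x₁ x₂ y₁ y₂ u₁ u₂ v₁ v₂ wₑ wₒ zₑ zₒ : Carrier) where
    open Weight x₁ x₂ y₁ y₂ u₁ u₂ v₁ v₂ wₑ wₒ zₑ zₒ

    private
      α = alphaCoeff x₁ x₂ y₁ y₂ u₁ u₂ v₁ v₂ wₑ wₒ
      δ = deltaCoeff zₑ zₒ

    α-odd : ∀ k → α (suc (double k)) ≡ (x₁ + k · u₁) * (y₁ + k · v₁)
    α-odd k rewrite double-*2 k | m*n%n≡0 k 2 ⦃ _ ⦄ | m*n/n≡m k 2 ⦃ _ ⦄ = ≡.refl

    α-even : ∀ k → α (suc (suc (double k))) ≡ (x₂ + k · u₂ + wₑ) * (y₂ + k · v₂ + wₒ)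
    α-even k rewrite double-*2 k | [m+kn]%n≡m%n 1 k 2 ⦃ _ ⦄
      | +-distrib-/-∣ʳ 1 {k ℕ.* 2} {2} ⦃ _ ⦄ (n∣m*n k) | m*n/n≡m k 2 ⦃ _ ⦄ = ≡.refl

    δ-zero : ∀ k → δ (suc (suc k)) ≈ 0#
    δ-zero k = refl

    open Fraction α δ

    -- evenSum weighs rises and falls separately, G puts the whole weight on the falls.
    rise : ℕ → Carrier
    rise k = (y₁ + k · v₁) * (x₂ + k · u₂ + wₑ)

    rises : ℕ → Carrier
    rises zero    = 1#
    rises (suc k) = rises k * rise k

    -- Both sides obey one three-term recursion. `rise k` is the weight of the half-steps from k to
    -- suc k arcs that keep or add an arc; times the fall back it gives the product of the
    -- coefficients 2k + 1 and 2k + 2 that `G` charges on the way down.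
    G-evenSum : ∀ n k → G δ-zero k n ≈ rises k * evenSum n k
    G-evenSum zero    zero    = trans (F-zero 1) (sym (*-identityˡ 1#))
    G-evenSum zero    (suc k) = trans (E-order (double (suc k)) (suc k) (s≤s (s≤s (k≤double k)))) (sym (zeroʳ _))
      where
      k≤double : ∀ k → k ≤ double k
      k≤double zero    = z≤n
      k≤double (suc k) = ℕₚ.m≤n⇒m≤1+n (s≤s (k≤double k))
    -- Without open arcs the half-steps through the odd state 0 are two fixed points weighing zₒ and
    -- zₑ, which is the source of δ₁.
    G-evenSum (suc n) zero    = begin
      G δ-zero 0 (suc n)
        ≈⟨ G-ground δ-zero n ⟩
      (zₑ * zₒ + (x₁ + 0#) * (y₁ + 0#)) * G δ-zero 0 n + G δ-zero 1 n
        ≈⟨ +-cong (*-congˡ (G-evenSum n 0)) (G-evenSum n 1) ⟩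
      (zₑ * zₒ + (x₁ + 0#) * (y₁ + 0#)) * (1# * evenSum n 0) + 1# * ((y₁ + 0#) * (x₂ + 0# + wₑ)) * evenSum n 1
        ≈⟨ solve 8 (λ ze zo x₁ y₁ x₂ we e₀ e₁ →
             (ze :* zo :+ (x₁ :+ con 0) :* (y₁ :+ con 0)) :* (con 1 :* e₀) :+ con 1 :* ((y₁ :+ con 0) :* (x₂ :+ con 0 :+ we)) :* e₁
             := con 1 :* ((e₀ :* (x₁ :+ con 0) :+ e₁ :* (x₂ :+ con 0 :+ we)) :* (y₁ :+ con 0)
                          :+ (e₀ :* con 0 :+ e₀ :* (con 0 :+ ze)) :* (con 0 :+ zo)))
             refl zₑ zₒ x₁ y₁ x₂ wₑ (evenSum n 0) (evenSum n 1) ⟩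
      1# * evenSum (suc n) 0 ∎
    G-evenSum (suc n) (suc j) = begin
      G δ-zero k (suc n)
        ≈⟨ G-step δ-zero j n ⟩
      α (suc (suc (double j))) * (α (suc (double j)) * G δ-zero j n + G δ-zero k n)
        + (α (suc (double k)) * G δ-zero k n + G δ-zero (suc k) n)
        ≈⟨ +-cong (*-cong (reflexive (α-even j)) (+-cong (*-cong (reflexive (α-odd j)) (G-evenSum n j)) (G-evenSum n k)))
                  (+-cong (*-cong (reflexive (α-odd k)) (G-evenSum n k)) (G-evenSum n (suc k))) ⟩
      (X₂ j + wₑ) * (Y₂ j + wₒ) * (X₁ j * Y₁ j * (rises j * evenSum n j) + rises k * evenSum n k)
        + (X₁ k * Y₁ k * (rises k * evenSum n k) + rises k * rise k * evenSum n (suc k))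
        ≈⟨ solve 13 (λ x₂j y₂j x₁j y₁j x₁k y₁k x₂k we wo r eⱼ eₖ eₛ → let rₖ = r :* (y₁j :* (x₂j :+ we)) in
             (x₂j :+ we) :* (y₂j :+ wo) :* (x₁j :* y₁j :* (r :* eⱼ) :+ rₖ :* eₖ)
               :+ (x₁k :* y₁k :* (rₖ :* eₖ) :+ rₖ :* (y₁k :* (x₂k :+ we)) :* eₛ)
             := rₖ :* ((eₖ :* x₁k :+ eₛ :* (x₂k :+ we)) :* y₁k :+ (eⱼ :* x₁j :+ eₖ :* (x₂j :+ we)) :* (y₂j :+ wo)))
             refl (X₂ j) (Y₂ j) (X₁ j) (Y₁ j) (X₁ k) (Y₁ k) (X₂ k) wₑ wₒ (rises j) (evenSum n j) (evenSum n k) (evenSum n (suc k)) ⟩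
      rises k * evenSum (suc n) k ∎
      where
      k = suc j
      X₁ X₂ Y₁ Y₂ : ℕ → Carrier
      X₁ k = x₁ + k · u₁
      X₂ k = x₂ + k · u₂
      Y₁ k = y₁ + k · v₁
      Y₂ k = y₂ + k · v₂

    convergent-evenSum : ∀ {n d} → n < d → convergent α δ d 1 n ≈ evenSum n 0
    convergent-evenSum {n} {d} n<d = begin
      convergent α δ d 1 n  ≈⟨ convergent-limit {d} n<d 1 ⟩
      F 1 n                 ≡⟨ ≡.cong (F 1) (ℕₚ.+-identityʳ n) ⟨
      G δ-zero 0 n          ≈⟨ G-evenSum n 0 ⟩
      1# * evenSum n 0      ≈⟨ *-identityˡ _ ⟩
      evenSum n 0 ∎

-- The polynomials of D-permutations as sums over words

module DPermutations {c ℓ : Level} (R : CommutativeRing c ℓ) where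

  open CommutativeRing R hiding (zero)
  open Ring R
  open Words
  open Encoding
  open WordSums R
  open TFraction R
  open import Algebra.Definitions.RawSemiring (Semiring.rawSemiring semiring) using (_^_)
  open import Algebra.Properties.CommutativeSemigroup *-commutativeSemigroup using (interchange)
  open import Relation.Binary.Reasoning.Setoid setoid

  ∏ : ∀ {m} → (Fin m → Carrier) → Carrier
  ∏ {zero}  f = 1#
  ∏ {suc m} f = f zero * ∏ (f ∘ suc)

  ∏-cong : ∀ {m} {f g : Fin m → Carrier} → (∀ i → f i ≈ g i) → ∏ f ≈ ∏ g
  ∏-cong {zero}  h = refl
  ∏-cong {suc m} h = *-cong (h zero) (∏-cong (h ∘ suc))

  ∏-one : ∀ m → ∏ {m} (λ _ → 1#) ≈ 1#
  ∏-one zero    = refl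
  ∏-one (suc m) = trans (*-identityˡ _) (∏-one m)

  ∏-* : ∀ {m} (f g : Fin m → Carrier) → ∏ (λ i → f i * g i) ≈ ∏ f * ∏ g
  ∏-* {zero}  f g = sym (*-identityˡ 1#)
  ∏-* {suc m} f g = trans (*-congˡ (∏-* (f ∘ suc) (g ∘ suc))) (interchange _ _ _ _)

  -- Turns a power whose exponent is a count into a product over indices, so that the monomial of a
  -- permutation splits into local factors. The map f generalises `allFin` for the sake of the
  -- induction.
  ^-length-filter : ∀ {m n} x (p : Fin n → Bool) (f : Fin m → Fin n) →
    x ^ length (filter (λ i → p i Bool.≟ true) (tabulate f)) ≈ ∏ (λ i → if p (f i) then x else 1#)
  ^-length-filter {zero}  x p f = refl
  ^-length-filter {suc m} x p f with p (f zero)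
  ... | true  = *-congˡ (^-length-filter x p (f ∘ suc))
  ... | false = trans (^-length-filter x p (f ∘ suc)) (sym (*-identityˡ _))

  selProd-∷ : ∀ b x l → (if b then x else 1#) * selProd l ≈ selProd ((b , x) ∷ l)
  selProd-∷ true  x l = refl
  selProd-∷ false x l = *-identityˡ _

  module _ {m : ℕ} (σ : Map m) where

    at : Fin m → List ((Fin m → Bool) × Carrier) → List (Bool × Carrier)
    at i = map (λ (p , x) → p i , x)

    powers : List ((Fin m → Bool) × Carrier) → Carrier
    powers = foldr (λ (p , x) acc → x ^ count σ p * acc) 1#

    powers-∏ : ∀ L → powers L ≈ ∏ (λ i → selProd (at i L))
    powers-∏ []            = sym (∏-one m)
    powers-∏ ((p , x) ∷ L) = trans (*-cong (^-length-filter x p (λ i → i)) (powers-∏ L))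
      (trans (sym (∏-* (λ i → if p i then x else 1#) (λ i → selProd (at i L)))) (∏-cong λ i → selProd-∷ (p i) x (at i L)))

    -- The monomial in `P` is a product bracketed to the left, that is, a `foldl` over the list of
    -- statistics.
    foldl-powers : ∀ a L → foldl (λ acc (p , x) → acc * x ^ count σ p) a L ≈ a * powers L
    foldl-powers a []            = sym (*-identityʳ a)
    foldl-powers a ((p , x) ∷ L) = trans (foldl-powers _ L) (*-assoc _ _ _)

  sumL-filter : ∀ {a} {A : Set a} (p : A → Bool) (f : A → Carrier) xs →
    sumL (map f (filter (λ x → p x Bool.≟ true) xs)) ≈ sumL (map (λ x → when (p x) (f x)) xs)
  sumL-filter p f []       = refl
  sumL-filter p f (x ∷ xs) with p x
  ... | true  = +-congˡ (sumL-filter p f xs)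
  ... | false = trans (sumL-filter p f xs) (sym (+-identityˡ _))

  sumL-++ : ∀ xs ys → sumL (xs List.++ ys) ≈ sumL xs + sumL ys
  sumL-++ []       ys = sym (+-identityˡ _)
  sumL-++ (x ∷ xs) ys = trans (+-congˡ (sumL-++ xs ys)) (sym (+-assoc _ _ _))

  sumL-concatMap : ∀ {a b} {A : Set a} {B : Set b} (f : B → Carrier) (h : A → List B) xs →
    sumL (map f (concatMap h xs)) ≈ sumL (map (λ x → sumL (map f (h x))) xs)
  sumL-concatMap f h []       = refl
  sumL-concatMap f h (x ∷ xs) = trans (reflexive (≡.cong sumL (map-++ f (h x) (concatMap h xs))))
    (trans (sumL-++ (map f (h x)) _) (+-congˡ (sumL-concatMap f h xs)))

  sumL-tabulate : ∀ n (h : Fin n → Carrier) f → (∀ i → h i ≈ f (toℕ i)) → sumL (tabulate h) ≈ ∑ n f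
  sumL-tabulate zero    h f e = refl
  sumL-tabulate (suc n) h f e = trans (+-cong (e zero) (sumL-tabulate n (h ∘ suc) (f ∘ suc) (e ∘ suc))) (sym (∑-head n f))

  sumL-allVecs : ∀ {N} m (g : Vec (Fin N) m → Carrier) f → (∀ v → g v ≈ f (word v)) →
    sumL (map g (allVecs N m)) ≈ sumWords N m f
  sumL-allVecs {N} zero    g f e = trans (+-identityʳ _) (e [])
  sumL-allVecs {N} (suc m) g f e = trans (sumL-concatMap g _ (allVecs N m))
    (sumL-allVecs m _ _ λ v → trans
      (reflexive (≡.cong sumL (≡.trans (≡.sym (map-∘ (List.allFin N))) (map-tabulate (λ i → i) (λ a → g (a ∷ v))))))
      (sumL-tabulate N _ (λ a → f (a ∷ word v)) λ a → e (a ∷ v)))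

  module _ (x₁ x₂ y₁ y₂ u₁ u₂ v₁ v₂ wₑ wₒ zₑ zₒ : Carrier) where
    open Weight x₁ x₂ y₁ y₂ u₁ u₂ v₁ v₂ wₑ wₒ zₑ zₒ

    private
      ∧-swap : ∀ a b c d → (a ∧ b) ∧ (c ∧ d) ≡ (a ∧ c) ∧ (b ∧ d)
      ∧-swap true  b true  d = ≡.refl
      ∧-swap true  b false d = ∧-zeroʳ b
      ∧-swap false b c     d = ≡.refl

      when-* : ∀ a b x y → when a (x * when b y) ≈ when (a ∧ b) (x * y)
      when-* true  true  x y = refl
      when-* true  false x y = zeroʳ x
      when-* false b     x y = refl

    dvalid : ℕ → List ℕ → Bool
    dvalid N []      = true
    dvalid N (a ∷ v) = dcond (N ∸ suc (length v)) a ∧ dvalid N v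

    W-word : ∀ {N m} (v : Vec (Fin N) m) →
      W N (word v) ≈ when (distinct (word v) ∧ dvalid N (word v))
        (∏ (λ i → head N (N ∸ suc (length (suffix v i))) (toℕ (lookup v i)) (suffix v i)))
    W-word         []      = refl
    W-word {N} (a ∷ v) = begin
      when (allowed p (toℕ a) (word v)) (h * W N (word v))
        ≈⟨ when-cong (allowed p (toℕ a) (word v)) (*-congˡ (W-word v)) ⟩
      when (allowed p (toℕ a) (word v)) (h * when (distinct (word v) ∧ dvalid N (word v)) rest)
        ≈⟨ when-* (allowed p (toℕ a) (word v)) (distinct (word v) ∧ dvalid N (word v)) h rest ⟩
      when (allowed p (toℕ a) (word v) ∧ distinct (word v) ∧ dvalid N (word v)) (h * rest)
        ≡⟨ ≡.cong (λ b → when b (h * rest))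
             (∧-swap (not (mem (word v) (toℕ a))) (dcond p (toℕ a)) (distinct (word v)) (dvalid N (word v))) ⟩
      when (distinct (word (a ∷ v)) ∧ dvalid N (word (a ∷ v))) (h * rest) ∎
      where
      p = N ∸ suc (length (word v))
      h = head N p (toℕ a) (word v)
      rest = ∏ (λ i → head N (N ∸ suc (length (suffix v i))) (toℕ (lookup v i)) (suffix v i))

    dvalid-word⁻ : ∀ {N m} (v : Vec (Fin N) m) → T (dvalid N (word v)) →
      ∀ i → T (dcond (N ∸ suc (length (suffix v i))) (toℕ (lookup v i)))
    dvalid-word⁻ {N} (a ∷ v) t zero    = proj₁ (∧⁻ t)
    dvalid-word⁻ {N} (a ∷ v) t (suc i) = dvalid-word⁻ v (proj₂ (∧⁻ {dcond (N ∸ suc (length (word v))) (toℕ a)} t)) i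

    dvalid-word⁺ : ∀ {N m} (v : Vec (Fin N) m) →
      (∀ i → T (dcond (N ∸ suc (length (suffix v i))) (toℕ (lookup v i)))) → T (dvalid N (word v))
    dvalid-word⁺ []      h = _
    dvalid-word⁺ (a ∷ v) h = ∧⁺ (h zero) (dvalid-word⁺ v (h ∘ suc))

    isDcond-dvalid : ∀ {N} (σ : Map N) → isDcond σ ≡ dvalid N (word σ)
    isDcond-dvalid σ = bool-ext
      (λ t → dvalid-word⁺ σ λ i → ≡.subst (λ p → T (dcond p (toℕ (lookup σ i)))) (≡.sym (position σ i)) (allFin⁻ t i))
      (λ t → allFin⁺ λ i → ≡.subst (λ p → T (dcond p (toℕ (lookup σ i)))) (position σ i) (dvalid-word⁻ σ t i))

    module _ {N : ℕ} (σ : Map N) where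

      stats : List ((Fin N → Bool) × Carrier)
      stats =
          ((λ i → earec σ i ∧ cpeak σ i) , x₁) ∷ ((λ i → earec σ i ∧ cdfall σ i) , x₂)
        ∷ ((λ i → erec σ i ∧ cval σ i) , y₁) ∷ ((λ i → erec σ i ∧ cdrise σ i) , y₂)
        ∷ ((λ i → nra σ i ∧ cpeak σ i) , u₁) ∷ ((λ i → nra σ i ∧ cdfall σ i) , u₂)
        ∷ ((λ i → nra σ i ∧ cval σ i) , v₁) ∷ ((λ i → nra σ i ∧ cdrise σ i) , v₂)
        ∷ ((λ i → nra σ i ∧ fixpt σ i ∧ not (oddIdx σ i)) , wₑ) ∷ ((λ i → nra σ i ∧ fixpt σ i ∧ oddIdx σ i) , wₒ)
        ∷ ((λ i → rar σ i ∧ not (oddIdx σ i)) , zₑ) ∷ ((λ i → rar σ i ∧ oddIdx σ i) , zₒ) ∷ []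

      weight : Carrier
      weight =
          (x₁ ^ eareccpeak σ) * (x₂ ^ eareccdfall σ) * (y₁ ^ ereccval σ) * (y₂ ^ ereccdrise σ)
        * (u₁ ^ nrcpeak σ) * (u₂ ^ nrcdfall σ) * (v₁ ^ nrcval σ) * (v₂ ^ nrcdrise σ)
        * (wₑ ^ evennrfix σ) * (wₒ ^ oddnrfix σ) * (zₑ ^ evenrar σ) * (zₒ ^ oddrar σ)

      weight-powers : weight ≈ powers σ stats
      weight-powers = foldl-powers σ (x₁ ^ eareccpeak σ) (List.drop 1 stats)

      stats-head : T (isPerm σ) → ∀ i →
        at σ i stats ≡ entries (rec N (toℕ (lookup σ i)) (suffix σ i)) (anti (toℕ (lookup σ i)) (suffix σ i))
          (not (mem (toℕ (lookup σ i) ∷ suffix σ i) (toℕ i))) (mem (suffix σ i) (toℕ i))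
          (toℕ (lookup σ i) <ᵇ toℕ i) (toℕ i <ᵇ toℕ (lookup σ i)) (toℕ (lookup σ i) ≡ᵇ toℕ i) (toℕ i % 2 ≡ᵇ 0)
      stats-head perm i = go (isRecord-rec σ perm i) (isAntirecord-anti σ i) (preLess-mem σ perm i) (preGreater-mem σ i) (fixpt-≡ᵇ σ i)
        where
        go : ∀ {r t pl pg eq} → isRecord σ i ≡ r → isAntirecord σ i ≡ t → preLess σ i ≡ pl → preGreater σ i ≡ pg → fixpt σ i ≡ eq →
          at σ i stats ≡ entries r t pl pg (toℕ (lookup σ i) <ᵇ toℕ i) (toℕ i <ᵇ toℕ (lookup σ i)) eq (toℕ i % 2 ≡ᵇ 0)
        go ≡.refl ≡.refl ≡.refl ≡.refl ≡.refl = ≡.refl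

      weight-W : when (isPerm σ ∧ isDcond σ) weight ≈ W N (word σ)
      weight-W = sym (trans (W-word σ) (trans
        (reflexive (≡.cong (λ b → when b (∏ heads)) (≡.sym (≡.cong₂ _∧_ (isPerm-distinct σ) (isDcond-dvalid σ)))))
        (go (isPerm σ) (isDcond σ) true⇒T)))
        where
        heads : Fin N → Carrier
        heads i = head N (N ∸ suc (length (suffix σ i))) (toℕ (lookup σ i)) (suffix σ i)
        -- The flags of σ are translated to those of its word under `isPerm σ`, so the products are
        -- compared only where the condition holds; elsewhere both sides are zero.
        go : ∀ b b′ → (b ≡ true → T (isPerm σ)) → when (b ∧ b′) (∏ heads) ≈ when (b ∧ b′) weight
        go false _     _ = refl
        go true  false _ = refl
        go true  true  h = sym (trans weight-powers (trans (powers-∏ σ stats) (∏-cong λ i → trans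
          (reflexive (≡.cong selProd (stats-head (h ≡.refl) i)))
          (reflexive (≡.cong (λ p → head N p (toℕ (lookup σ i)) (suffix σ i)) (≡.sym (position σ i)))))))

    P-evenSum : ∀ n → P x₁ x₂ y₁ y₂ u₁ u₂ v₁ v₂ wₑ wₒ zₑ zₒ n ≈ evenSum n 0
    P-evenSum n = begin
      P x₁ x₂ y₁ y₂ u₁ u₂ v₁ v₂ wₑ wₒ zₑ zₒ n
        ≈⟨ sumL-filter (λ σ → isPerm σ ∧ isDcond σ) weight (allVecs N N) ⟩
      sumL (map (λ σ → when (isPerm σ ∧ isDcond σ) (weight σ)) (allVecs N N))
        ≈⟨ sumL-allVecs N _ (W N) weight-W ⟩
      sumWords N N (W N)
        ≡⟨ ≡.cong (λ M → sumWords N M (W N)) double-2* ⟩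
      -- No value lies below position 0, so the match condition is void and any `H` would serve.
      stateSum N (double n) 0 (λ _ → false)
        ≈⟨ stateSum-even n 0 (≡.trans (ℕₚ.+-identityʳ _) (≡.sym double-2*)) ≡.refl (λ _ → false) ⟩
      evenSum n 0 ∎
      where
      N = 2 ℕ.* n
      double-2* : N ≡ double n
      double-2* = ≡.trans (ℕₚ.*-comm 2 n) (≡.sym (double-*2 n))

-- The identity of power series is stated coefficient by coefficient: beyond depth n the coefficient
-- of the n-th power of t in the convergents is that of the fraction. The polynomial identity is the
-- case of the polynomial ring over the integers and its variables.
theorem3p3 : ∀ {c ℓ : Level} (R : CommutativeRing c ℓ)
    (x₁ x₂ y₁ y₂ u₁ u₂ v₁ v₂ wₑ wₒ zₑ zₒ : CommutativeRing.Carrier R)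
    (n d : ℕ) → n < d →
    CommutativeRing._≈_ R
    (Ring.convergent R (Ring.alphaCoeff R x₁ x₂ y₁ y₂ u₁ u₂ v₁ v₂ wₑ wₒ) (Ring.deltaCoeff R zₑ zₒ) d 1 n)
    (Ring.P R x₁ x₂ y₁ y₂ u₁ u₂ v₁ v₂ wₑ wₒ zₑ zₒ n)
theorem3p3 R x₁ x₂ y₁ y₂ u₁ u₂ v₁ v₂ wₑ wₒ zₑ zₒ n d n<d = trans
  (convergent-evenSum x₁ x₂ y₁ y₂ u₁ u₂ v₁ v₂ wₑ wₒ zₑ zₒ n<d)
  (sym (P-evenSum x₁ x₂ y₁ y₂ u₁ u₂ v₁ v₂ wₑ wₒ zₑ zₒ n))
  where
  open CommutativeRing R using (sym; trans)
  open TFraction R using (convergent-evenSum)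
  open DPermutations R using (P-evenSum)
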